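{- Let $k\geq 4$ and let $\mathcal{C}_k$ denote the family of all non-monochromatic bicolored cycles of length $k$. Then $\mathrm{ex}(\tfrac12,\mathcal{C}_k)=\tfrac12$.
   Context: A bicolored graph is a simple graph whose edges are each colored red or blue; it is non-monochromatic if both colors occur. A bicolored graph $G$ is $\varepsilon$-balanced if each color class contains at least $\varepsilon\cdot e(G)$ edges. $G$ contains $F$ if there is an injective map $V(F)\to V(G)$ sending every edge of $F$ to an edge of $G$ of the same color. For a family $\mathcal{F}$ of bicolored graphs, $\mathrm{ex}(\varepsilon,n,\mathcal{F})$ is the maximum number of edges of an $n$-vertex $\varepsilon$-balanced bicolored graph containing no member of $\mathcal{F}$, and $\mathrm{ex}(\varepsilon,\mathcal{F}):=\lim_{n\to\infty}\mathrm{ex}(\varepsilon,n,\mathcal{F})/\binom{n}{2}$. -}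

module Defs where

open import Data.Nat using (ℕ; zero; suc; _+_; _*_; _≤_; _<ᵇ_)
open import Data.Nat.DivMod using (_mod_)
open import Data.Bool using (Bool; true; false; if_then_else_)
open import Data.Maybe using (Maybe; just; nothing)
open import Data.Fin using (Fin; toℕ)
open import Data.List using (List; map; allFin)
open import Data.Nat.ListAction using (sum)
open import Data.Product using (∃; ∃-syntax; _×_)
open import Relation.Binary.PropositionalEquality using (_≡_; _≢_)
open import Function.Definitions using (Injective)

-- A bicolored simple graph on vertex set Fin n.
-- adj i j = nothing : no edge; just true : red edge; just false : blue edge.
record BiGraph (n : ℕ) : Set where
  field
    adj    : Fin n → Fin n → Maybe Bool
    sym    : ∀ i j → adj i j ≡ adj j i
    irrefl : ∀ i → adj i i ≡ nothing
open BiGraph public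

pairSum : {n : ℕ} → (Fin n → Fin n → ℕ) → ℕ
pairSum {n} f = sum (map (λ i → sum (map (λ j → if toℕ i <ᵇ toℕ j then f i j else 0) (allFin n))) (allFin n))

edgeInd : Maybe Bool → ℕ
edgeInd nothing  = 0
edgeInd (just _) = 1

colInd : Bool → Maybe Bool → ℕ
colInd true  (just true)  = 1
colInd false (just false) = 1
colInd _     _            = 0

edges : {n : ℕ} → BiGraph n → ℕ
edges G = pairSum (λ i j → edgeInd (adj G i j))

colEdges : {n : ℕ} → Bool → BiGraph n → ℕ
colEdges c G = pairSum (λ i j → colInd c (adj G i j))

Balanced : (p q : ℕ) → {n : ℕ} → BiGraph n → Set
Balanced p q G = (p * edges G ≤ q * colEdges true G) × (p * edges G ≤ q * colEdges false G)

next : {k : ℕ} → Fin k → Fin k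
next {suc k} i = suc (toℕ i) mod (suc k)

-- A bicolored cycle of length k: vertices 0..k-1, edge {i, i+1 mod k} gets colour col i.
BiCycleColouring : ℕ → Set
BiCycleColouring k = Fin k → Bool

NonMonochromatic : {k : ℕ} → BiCycleColouring k → Set
NonMonochromatic col = ∃[ i ] ∃[ j ] col i ≢ col j

ContainsCycle : {n k : ℕ} → BiGraph n → BiCycleColouring k → Set
ContainsCycle {n} {k} G col =
  ∃[ f ] (Injective _≡_ _≡_ f × (∀ (i : Fin k) → adj G (f i) (f (next i)) ≡ just (col i)))

ContainsNonMonoCycle : {n : ℕ} → ℕ → BiGraph n → Set
ContainsNonMonoCycle k G = ∃[ col ] (NonMonochromatic {k} col × ContainsCycle G col)

{-# OPTIONS --safe #-}
module Submission where

-- Lower bound: a red and a blue clique of size n/2.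
--
-- Upper bound: call a triangle abc with a pendant edge ad whose colour differs
-- from that of ab a kite. If a positive fraction of all 4-tuples are kites, then
-- fixing c and d and applying Kővári–Sós–Turán to the pairs (a , b) gives a
-- complete bipartite pattern, and d a₀ b₀ a₁ b₁ … [c] a′ is a non-monochromatic
-- cycle of any prescribed length ≥ 4. So kites are rare, and hence almost every
-- vertex with many edges of both colours has a nearly edgeless neighbourhood.
-- Let X and Y be the vertices with few blue, respectively few red, edges; there
-- are few edges between them. If |X| ≥ n/2 then the blue edges essentially live
-- on n/2 vertices, so there are at most about n²/8 of them, and balancedness
-- finishes; likewise for Y. Otherwise let u be a mixed vertex of maximum degree,
-- g = N(u), let w be a mixed vertex in g with most neighbours in X ∪ Y, and let
-- h = N(w) ∖ g. As g and h are nearly edgeless, counting non-edges inside X and Y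
-- and counting the edges at mixed vertices, split into those outside g (M₁) and
-- inside g (M₂), reduces 4 e(G) ≤ n² + o(n²) to a quadratic inequality in the
-- sizes of the classes and of their intersections with g and h.

open import Defs hiding (sym)
open import Data.Nat using (ℕ; zero; suc; _+_; _*_; _∸_; _^_; _≤_; _<_; _≤?_; _<?_; _<ᵇ_; z≤n; s≤s; >-nonZero)
open import Data.Nat.Properties
open import Data.Nat.DivMod using (_%_; _/_; _mod_; m<n⇒m%n≡m; n%n≡0; m≡m%n+[m/n]*n; m%n<n)
open import Data.Nat.Combinatorics using (_C_; nC1≡n; nCk+nC[k+1]≡[n+1]C[k+1])
import Data.Nat.ListAction as ListAction
open import Data.Nat.Tactic.RingSolver using (solve-∀)
open import Data.Bool using (Bool; true; false; _∧_; _∨_; not; if_then_else_; T)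
import Data.Bool.Properties as Bool
open import Data.Maybe using (Maybe; just; nothing)
open import Data.Maybe.Properties using (just-injective)
open import Data.Fin using (Fin; zero; suc; toℕ; inject₁)
import Data.Fin.Properties as Fin
open import Data.List as List using (List; []; _∷_; length; lookup; allFin)
open import Data.List.Properties using (length-map; map-tabulate)
open import Data.List.Membership.Propositional.Properties using (∈-lookup)
open import Data.List.Relation.Unary.All as All using (All; []; _∷_)
import Data.List.Relation.Unary.All.Properties as All
open import Data.List.Relation.Unary.AllPairs using ([]; _∷_)
open import Data.List.Relation.Unary.Unique.Propositional using (Unique)
import Data.List.Relation.Unary.Unique.Propositional.Properties as Unique
open import Data.Product using (∃-syntax; Σ-syntax; _×_; _,_; proj₁; proj₂)
open import Data.Sum using (_⊎_; inj₁; inj₂)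
open import Data.Unit using (tt)
open import Function using (_∘_; id)
open import Relation.Nullary using (¬_; Dec; yes; no; contradiction; ⌊_⌋)
open import Relation.Nullary.Decidable using (toWitness; _→-dec_; _⊎-dec_)
open import Relation.Binary using (Symmetric)
open import Relation.Binary.PropositionalEquality using (_≡_; _≢_; refl; sym; trans; cong; cong₂; subst)
open import Algebra.Properties.Semiring.Sum +-*-semiring
  using (sum; sum-cong-≗; ∑-distrib-+; ∑-comm; *-distribˡ-sum; *-distribʳ-sum)

-- Finite sums

𝟙 : Bool → ℕ
𝟙 true  = 1
𝟙 false = 0

𝟙≤1 : ∀ b → 𝟙 b ≤ 1
𝟙≤1 true  = ≤-refl
𝟙≤1 false = z≤n

module _ {n : ℕ} where

  # : (Fin n → Bool) → ℕ
  # p = sum (λ i → 𝟙 (p i))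

  ∑∑ : (Fin n → Fin n → ℕ) → ℕ
  ∑∑ f = sum (λ i → sum (f i))

sum-mono : ∀ {n} {f g : Fin n → ℕ} → (∀ i → f i ≤ g i) → sum f ≤ sum g
sum-mono {zero}  h = z≤n
sum-mono {suc n} h = +-mono-≤ (h zero) (sum-mono (h ∘ suc))

sum-const : ∀ n c → sum {n} (λ _ → c) ≡ n * c
sum-const zero    c = refl
sum-const (suc n) c = cong (c +_) (sum-const n c)

sum-bound : ∀ {n} {f : Fin n → ℕ} c → (∀ i → f i ≤ c) → sum f ≤ n * c
sum-bound {n} c h = ≤-trans (sum-mono h) (≤-reflexive (sum-const n c))

#≤n : ∀ {n} (p : Fin n → Bool) → # p ≤ n
#≤n {n} p = ≤-trans (sum-bound 1 (λ i → 𝟙≤1 (p i))) (≤-reflexive (*-identityʳ n))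

module _ {n : ℕ} where

  ∑∑-mono : {f g : Fin n → Fin n → ℕ} → (∀ i j → f i j ≤ g i j) → ∑∑ f ≤ ∑∑ g
  ∑∑-mono h = sum-mono (λ i → sum-mono (h i))

  ∑∑-cong : {f g : Fin n → Fin n → ℕ} → (∀ i j → f i j ≡ g i j) → ∑∑ f ≡ ∑∑ g
  ∑∑-cong h = sum-cong-≗ (λ i → sum-cong-≗ (h i))

  ∑∑-+ : (f g : Fin n → Fin n → ℕ) → ∑∑ (λ i j → f i j + g i j) ≡ ∑∑ f + ∑∑ g
  ∑∑-+ f g = trans (sum-cong-≗ (λ i → ∑-distrib-+ (f i) (g i))) (∑-distrib-+ (sum ∘ f) (sum ∘ g))

  ∑∑-* : (f g : Fin n → ℕ) → ∑∑ (λ i j → f i * g j) ≡ sum f * sum g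
  ∑∑-* f g = trans (sum-cong-≗ (λ i → sym (*-distribˡ-sum (f i) g))) (sym (*-distribʳ-sum (sum g) f))

  ∑∑-*ˡ : ∀ c (f : Fin n → Fin n → ℕ) → ∑∑ (λ i j → c * f i j) ≡ c * ∑∑ f
  ∑∑-*ˡ c f = trans (sum-cong-≗ (λ i → sym (*-distribˡ-sum c (f i)))) (sym (*-distribˡ-sum c (sum ∘ f)))

  sum-factor : ∀ {f : Fin n → ℕ} {g : Fin n → Fin n → ℕ} →
               ∑∑ (λ i j → f i * g i j) ≡ sum (λ i → f i * sum (g i))
  sum-factor {f} {g} = sum-cong-≗ (λ i → sym (*-distribˡ-sum (f i) (g i)))

pigeonhole : ∀ {n} (f : Fin n → ℕ) c → 0 < n → n * c ≤ sum f → ∃[ i ] c ≤ f i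
pigeonhole {suc n} f c _ = go n f
  where
  go : ∀ n (f : Fin (suc n) → ℕ) → suc n * c ≤ sum f → ∃[ i ] c ≤ f i
  go zero    f h = zero , subst (_≤ f zero) (+-identityʳ c) (≤-trans h (≤-reflexive (+-identityʳ (f zero))))
  go (suc n) f h with ≤-total c (f zero)
  ... | inj₁ c≤f = zero , c≤f
  ... | inj₂ f≤c with go n (f ∘ suc) (+-cancelˡ-≤ c _ _ (≤-trans h (+-monoˡ-≤ _ f≤c)))
  ...   | i , c≤fi = suc i , c≤fi

argmax : ∀ {n} (p : Fin n → Bool) (f : Fin n → ℕ) →
         (∀ i → p i ≡ false) ⊎ (∃[ i ] p i ≡ true × (∀ j → p j ≡ true → f j ≤ f i))
argmax {zero}  p f = inj₁ λ ()
argmax {suc n} p f with argmax (p ∘ suc) (f ∘ suc) | p zero in p₀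
... | inj₁ none | false = inj₁ λ { zero → p₀ ; (suc i) → none i }
... | inj₁ none | true  = inj₂ (zero , p₀ , λ
  { zero    _ → ≤-refl
  ; (suc j) q → contradiction (trans (sym q) (none j)) λ () })
... | inj₂ (i , pi , max) | false = inj₂ (suc i , pi , λ
  { zero    q → contradiction (trans (sym q) p₀) λ ()
  ; (suc j) q → max j q })
... | inj₂ (i , pi , max) | true with ≤-total (f zero) (f (suc i))
...   | inj₁ f₀≤ = inj₂ (suc i , pi , λ { zero _ → f₀≤ ; (suc j) q → max j q })
...   | inj₂ ≤f₀ = inj₂ (zero , p₀ , λ { zero _ → ≤-refl ; (suc j) q → ≤-trans (max j q) ≤f₀ })

-- Complete bipartite patterns in dense relations

𝟙-∧ : ∀ a b → 𝟙 (a ∧ b) ≡ 𝟙 a * 𝟙 b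
𝟙-∧ true  b = sym (+-identityʳ (𝟙 b))
𝟙-∧ false b = refl

∧-trueˡ : ∀ {a b} → a ∧ b ≡ true → a ≡ true
∧-trueˡ {true} _ = refl

∧-trueʳ : ∀ {a b} → a ∧ b ≡ true → b ≡ true
∧-trueʳ {true} h = h

#-choose : ∀ {n} k (p : Fin n → Bool) → k ≤ # p →
           ∃[ xs ] length xs ≡ k × Unique xs × All (λ x → p x ≡ true) xs
#-choose         zero    p h = [] , refl , [] , []
#-choose {suc n} (suc k) p h with p zero in p₀
... | true  = let xs , len , uniq , all = #-choose k (p ∘ suc) (≤-pred h) in
  zero ∷ List.map suc xs , cong suc (trans (length-map suc xs) len) ,
  All.map⁺ (All.tabulate (λ _ ())) ∷ Unique.map⁺ Fin.suc-injective uniq ,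
  p₀ ∷ All.map⁺ all
... | false = let xs , len , uniq , all = #-choose (suc k) (p ∘ suc) h in
  List.map suc xs , trans (length-map suc xs) len , Unique.map⁺ Fin.suc-injective uniq , All.map⁺ all

#-singleton : ∀ {n} (x : Fin n) → # (λ i → ⌊ x Fin.≟ i ⌋) ≡ 1
#-singleton {suc n} zero    = cong suc (trans (sum-const n 0) (*-zeroʳ n))
#-singleton {suc n} (suc x) = trans (sum-cong-≗ lemma) (#-singleton x)
  where
  lemma : ∀ i → 𝟙 ⌊ suc x Fin.≟ suc i ⌋ ≡ 𝟙 ⌊ x Fin.≟ i ⌋
  lemma i with x Fin.≟ i
  ... | yes _ = refl
  ... | no  _ = refl

#-remove : ∀ {n} (p : Fin n → Bool) x → # p ≤ # (λ i → p i ∧ not ⌊ x Fin.≟ i ⌋) + 1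
#-remove p x = ≤-trans (sum-mono (λ i → lemma (p i) ⌊ x Fin.≟ i ⌋))
  (≤-trans (≤-reflexive (∑-distrib-+ (λ i → 𝟙 (p i ∧ not ⌊ x Fin.≟ i ⌋)) _)) (+-monoʳ-≤ _ (≤-reflexive (#-singleton x))))
  where
  lemma : ∀ a b → 𝟙 a ≤ 𝟙 (a ∧ not b) + 𝟙 b
  lemma true  true  = ≤-refl
  lemma true  false = ≤-refl
  lemma false b     = z≤n

#-swap : ∀ {n} (w : Fin n → Bool) (Q : Fin n → Fin n → Bool) →
         sum (λ a → # (λ b → w b ∧ Q a b)) ≡ sum (λ b → 𝟙 (w b) * # (λ a → Q a b))
#-swap w Q = trans (∑-comm (λ a b → 𝟙 (w b ∧ Q a b)))
  (sum-cong-≗ (λ b → trans (sum-cong-≗ (λ a → 𝟙-∧ (w b) (Q a b))) (sym (*-distribˡ-sum (𝟙 (w b)) (λ a → 𝟙 (Q a b))))))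

Joined : ∀ {n} → (Fin n → Fin n → Bool) → List (Fin n) → List (Fin n) → Set
Joined Q as bs = All (λ a → All (λ b → Q a b ≡ true) bs) as

-- The a's are picked one at a time, each time keeping a fraction 1/L of the
-- b's; deleting a picked vertex costs every b only one neighbour.
pick-common : ∀ {n} L j (Q : Fin n → Fin n → Bool) (w : Fin n → Bool) → 0 < n →
  (∀ b → w b ≡ true → n + L * j ≤ L * # (λ a → Q a b)) →
  ∃[ as ] ∃[ w′ ] length as ≡ j × # w ≤ L ^ j * # w′ ×
    (∀ b → w′ b ≡ true → w b ≡ true) ×
    All (λ a → ∀ b → w′ b ≡ true → Q a b ≡ true) as ×
    (∀ b → w′ b ≡ true → Unique as)
pick-common     L zero    Q w 0<n deg = [] , w , refl , ≤-reflexive (sym (+-identityʳ _)) , (λ _ h → h) , [] , λ _ _ → []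
pick-common {n} L (suc j) Q w 0<n deg
  with pigeonhole (λ a → L * # (λ b → w b ∧ Q a b)) (# w) 0<n average
  where
  lemma : ∀ b → n * 𝟙 (w b) ≤ L * (𝟙 (w b) * # (λ a → Q a b))
  lemma b with w b in wb
  ... | false = ≤-trans (≤-reflexive (*-zeroʳ n)) z≤n
  ... | true  = ≤-trans (≤-reflexive (*-identityʳ n)) (≤-trans (m≤m+n n _) (≤-trans (deg b wb)
                  (≤-reflexive (cong (L *_) (sym (+-identityʳ _))))))
  average : n * # w ≤ sum (λ a → L * # (λ b → w b ∧ Q a b))
  average = begin
    n * # w                                         ≡⟨ *-distribˡ-sum n (λ b → 𝟙 (w b)) ⟩
    sum (λ b → n * 𝟙 (w b))                         ≤⟨ sum-mono lemma ⟩
    sum (λ b → L * (𝟙 (w b) * # (λ a → Q a b)))     ≡⟨ *-distribˡ-sum L (λ b → 𝟙 (w b) * # (λ a → Q a b)) ⟨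
    L * sum (λ b → 𝟙 (w b) * # (λ a → Q a b))       ≡⟨ cong (L *_) (#-swap w Q) ⟨
    L * sum (λ a → # (λ b → w b ∧ Q a b))           ≡⟨ *-distribˡ-sum L (λ a → # (λ b → w b ∧ Q a b)) ⟩
    sum (λ a → L * # (λ b → w b ∧ Q a b))           ∎
    where open ≤-Reasoning
... | a , #w≤ with pick-common L j Q′ (λ b → w b ∧ Q a b) 0<n deg′
  where
  Q′ : Fin n → Fin n → Bool
  Q′ a′ b = Q a′ b ∧ not ⌊ a Fin.≟ a′ ⌋
  deg′ : ∀ b → w b ∧ Q a b ≡ true → n + L * j ≤ L * # (λ a′ → Q′ a′ b)
  deg′ b wb = +-cancelʳ-≤ (L * 1) _ _ (begin
    n + L * j + L * 1               ≡⟨ shift n L j ⟩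
    n + L * suc j                   ≤⟨ deg b (∧-trueˡ wb) ⟩
    L * # (λ a′ → Q a′ b)           ≤⟨ *-monoʳ-≤ L (#-remove (λ a′ → Q a′ b) a) ⟩
    L * (# (λ a′ → Q′ a′ b) + 1)    ≡⟨ *-distribˡ-+ L (# (λ a′ → Q′ a′ b)) 1 ⟩
    L * # (λ a′ → Q′ a′ b) + L * 1  ∎)
    where
    open ≤-Reasoning
    shift : ∀ n L j → n + L * j + L * 1 ≡ n + L * (1 + j)
    shift = solve-∀
...   | as , w′ , len , #≤ , w′⊆ , all , uniq =
  a ∷ as , w′ , cong suc len ,
  ≤-trans #w≤ (≤-trans (*-monoʳ-≤ L #≤) (≤-reflexive (sym (*-assoc L (L ^ j) (# w′))))) ,
  (λ b h → ∧-trueˡ (w′⊆ b h)) ,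
  (λ b h → ∧-trueʳ (w′⊆ b h)) ∷ All.map (λ q b h → ∧-trueˡ (q b h)) all ,
  -- A surviving `b` is related by `Q′` to every later vertex, and `Q′` excludes `a`. Distinctness
  -- is read off from such a `b`, which is why it is conditional on one.
  λ b h → All.map (λ {a′} q → a≢ a′ (∧-trueʳ (q b h))) all ∷ uniq b h
  where
  a≢ : ∀ a′ → not ⌊ a Fin.≟ a′ ⌋ ≡ true → a ≢ a′
  a≢ a′ h with a Fin.≟ a′
  a≢ a′ () | yes _
  a≢ a′ h  | no a≢a′ = a≢a′

-- Those b with fewer than n/(2L) partners account for at most n²/(2L) pairs, half of the assumed
-- n²/L. The other half falls on b with at most n partners each, so there are at least n/(2L) of
-- them.
popular : ∀ {n} L (Q : Fin n → Fin n → Bool) → 0 < n → n * n ≤ L * ∑∑ (λ a b → 𝟙 (Q a b)) →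
  ∃[ w ] (∀ b → w b ≡ true → n ≤ 2 * L * # (λ a → Q a b)) × n ≤ 2 * L * # w
popular {n} L Q 0<n dense = w , popular-deg , many
  where
  deg# : Fin n → ℕ
  deg# b = # (λ a → Q a b)
  w : Fin n → Bool
  w b = ⌊ n ≤? 2 * L * deg# b ⌋
  popular-deg : ∀ b → w b ≡ true → n ≤ 2 * L * deg# b
  popular-deg b h with n ≤? 2 * L * deg# b
  ... | yes n≤ = n≤
  pointwise : ∀ b → 2 * L * deg# b ≤ 2 * L * n * 𝟙 (w b) + n
  pointwise b with n ≤? 2 * L * deg# b
  ... | yes _  = ≤-trans (*-monoʳ-≤ (2 * L) (#≤n (λ a → Q a b)))
                   (≤-trans (≤-reflexive (sym (*-identityʳ (2 * L * n)))) (m≤m+n _ n))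
  ... | no n≰  = ≤-trans (<⇒≤ (≰⇒> n≰)) (m≤n+m n _)
  total : 2 * (n * n) ≤ n * (2 * L * # w) + n * n
  total = begin
    2 * (n * n)                              ≤⟨ *-monoʳ-≤ 2 dense ⟩
    2 * (L * ∑∑ (λ a b → 𝟙 (Q a b)))         ≡⟨ *-assoc 2 L (∑∑ (λ a b → 𝟙 (Q a b))) ⟨
    2 * L * ∑∑ (λ a b → 𝟙 (Q a b))           ≡⟨ cong (2 * L *_) (∑-comm (λ a b → 𝟙 (Q a b))) ⟩
    2 * L * sum deg#                         ≡⟨ *-distribˡ-sum (2 * L) deg# ⟩
    sum (λ b → 2 * L * deg# b)               ≤⟨ sum-mono pointwise ⟩
    sum (λ b → 2 * L * n * 𝟙 (w b) + n)      ≡⟨ ∑-distrib-+ (λ b → 2 * L * n * 𝟙 (w b)) (λ _ → n) ⟩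
    sum (λ b → 2 * L * n * 𝟙 (w b)) + sum {n} (λ _ → n)
      ≡⟨ cong₂ _+_ (sym (*-distribˡ-sum (2 * L * n) (λ b → 𝟙 (w b)))) (sum-const n n) ⟩
    2 * L * n * # w + n * n                  ≡⟨ cong (_+ n * n) (swap L n (# w)) ⟩
    n * (2 * L * # w) + n * n                ∎
    where
    open ≤-Reasoning
    swap : ∀ L n w → 2 * L * n * w ≡ n * (2 * L * w)
    swap = solve-∀
  many : n ≤ 2 * L * # w
  many = *-cancelˡ-≤ n {{>-nonZero 0<n}} (+-cancelʳ-≤ (n * n) _ _
    (≤-trans (≤-reflexive (cong (n * n +_) (sym (+-identityʳ (n * n))))) total))

-- Kővári-Sós-Turán by greedy choice. A popular b has degree at least n/(2L), so 4L times its degree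
-- is at least 2n, and `large₁` lets this cover n plus the slack `4 * L * k` spent on the deletions.
-- By `large₂`, at least `k` of the popular vertices survive `k` losses of a factor 4L.
complete-bipartite : ∀ {n} L k (Q : Fin n → Fin n → Bool) → 0 < n → 0 < L → 0 < k →
  4 * L * k ≤ n → 2 * L * ((4 * L) ^ k * k) ≤ n →
  n * n ≤ L * ∑∑ (λ a b → 𝟙 (Q a b)) →
  ∃[ as ] ∃[ bs ] length as ≡ k × length bs ≡ k × Unique as × Unique bs × Joined Q as bs
complete-bipartite {n} L k Q 0<n 0<L 0<k large₁ large₂ dense =
  let w , deg , many = popular L Q 0<n dense
      as , w′ , lenₐ , #≤ , _ , all , uniq = pick-common (4 * L) k Q w 0<n (deg′ w deg)
      bs , len , uniq′ , w′bs = #-choose k w′ (enough w w′ many #≤)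
  in as , bs , lenₐ , len , unique w′ as uniq bs (subst (0 <_) (sym len) 0<k) w′bs , uniq′ ,
     All.map (λ q → All.map (λ {b} → q b) w′bs) all
  where
  deg′ : ∀ w → (∀ b → w b ≡ true → n ≤ 2 * L * # (λ a → Q a b)) →
         ∀ b → w b ≡ true → n + 4 * L * k ≤ 4 * L * # (λ a → Q a b)
  deg′ w deg b h = ≤-trans (+-mono-≤ (deg b h) (≤-trans large₁ (deg b h)))
                           (≤-reflexive (double L (# (λ a → Q a b))))
    where
    double : ∀ L d → 2 * L * d + 2 * L * d ≡ 4 * L * d
    double = solve-∀
  factor>0 : 0 < 2 * L * (4 * L) ^ k
  factor>0 = *-mono-< {0} {2 * L} {0} (*-mono-< {0} {2} {0} (s≤s z≤n) 0<L)
    (m^n>0 (4 * L) {{>-nonZero (*-mono-< {0} {4} {0} (s≤s z≤n) 0<L)}} k)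
  enough : ∀ (w w′ : Fin n → Bool) → n ≤ 2 * L * # w → # w ≤ (4 * L) ^ k * # w′ → k ≤ # w′
  enough w w′ many #≤ = *-cancelˡ-≤ (2 * L * (4 * L) ^ k) {{>-nonZero factor>0}} (begin
    2 * L * (4 * L) ^ k * k      ≡⟨ *-assoc (2 * L) ((4 * L) ^ k) k ⟩
    2 * L * ((4 * L) ^ k * k)    ≤⟨ large₂ ⟩
    n                            ≤⟨ many ⟩
    2 * L * # w                  ≤⟨ *-monoʳ-≤ (2 * L) #≤ ⟩
    2 * L * ((4 * L) ^ k * # w′) ≡⟨ *-assoc (2 * L) ((4 * L) ^ k) (# w′) ⟨
    2 * L * (4 * L) ^ k * # w′   ∎)
    where open ≤-Reasoning
  unique : ∀ (w′ : Fin n → Bool) as → (∀ b → w′ b ≡ true → Unique as) →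
           ∀ bs → 0 < length bs → All (λ b → w′ b ≡ true) bs → Unique as
  unique w′ as uniq (b ∷ bs) _ (h ∷ _) = uniq b h

-- Cycles from zigzag walks

lookup-injective : ∀ {A : Set} {xs : List A} → Unique xs → ∀ {i j} → lookup xs i ≡ lookup xs j → i ≡ j
lookup-injective (x∉ ∷ u) {zero}  {zero}  _ = refl
lookup-injective (x∉ ∷ u) {zero}  {suc j} e = contradiction e (All.lookup x∉ (∈-lookup j))
lookup-injective (x∉ ∷ u) {suc i} {zero}  e = contradiction (sym e) (All.lookup x∉ (∈-lookup i))
lookup-injective (x∉ ∷ u) {suc i} {suc j} e = cong suc (lookup-injective u e)

toℕ-mod : ∀ m {k} → toℕ (m mod suc k) ≡ m % suc k
toℕ-mod m = Fin.toℕ-fromℕ< _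

module _ {A : Set} where

  -- The last entry is followed by `z`; choosing `z` to be the head of the list closes it into a
  -- cycle.
  successor : (xs : List A) → A → Fin (length xs) → A
  successor (x ∷ [])     z zero    = z
  successor (x ∷ y ∷ xs) z zero    = y
  successor (x ∷ y ∷ xs) z (suc i) = successor (y ∷ xs) z i

  successor-lookup : ∀ xs z i (j : Fin (length xs)) → suc (toℕ i) ≡ toℕ j → successor xs z i ≡ lookup xs j
  successor-lookup (x ∷ y ∷ xs) z zero    (suc zero) eq = refl
  successor-lookup (x ∷ y ∷ xs) z (suc i) (suc j)    eq = successor-lookup (y ∷ xs) z i j (suc-injective eq)

  successor-last : ∀ xs z (i : Fin (length xs)) → suc (toℕ i) ≡ length xs → successor xs z i ≡ z
  successor-last (x ∷ [])     z zero    eq = refl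
  successor-last (x ∷ y ∷ xs) z (suc i) eq = successor-last (y ∷ xs) z i (suc-injective eq)

  lookup-next : ∀ x (xs : List A) i → lookup (x ∷ xs) (next i) ≡ successor (x ∷ xs) x i
  lookup-next x xs i with suc (toℕ i) <? length (x ∷ xs)
  ... | yes <len = sym (successor-lookup (x ∷ xs) x i (next i)
                     (sym (trans (toℕ-mod (suc (toℕ i))) (m<n⇒m%n≡m <len))))
  ... | no  ≮len = trans (cong (lookup (x ∷ xs)) next≡0) (sym (successor-last (x ∷ xs) x i last))
    where
    last : suc (toℕ i) ≡ length (x ∷ xs)
    last = ≤-antisym (Fin.toℕ<n i) (≮⇒≥ ≮len)
    next≡0 : next i ≡ zero
    next≡0 = Fin.toℕ-injective (trans (toℕ-mod (suc (toℕ i)))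
      (trans (cong (_% length (x ∷ xs)) last) (n%n≡0 (length (x ∷ xs)))))

  data Walk (R : A → A → Set) (z : A) : List A → Set where
    end : ∀ {x} → R x z → Walk R z (x ∷ [])
    _∷_ : ∀ {x y xs} → R x y → Walk R z (y ∷ xs) → Walk R z (x ∷ y ∷ xs)

  walk-successor : ∀ {R z xs} → Walk R z xs → ∀ i → R (lookup xs i) (successor xs z i)
  walk-successor (end r) zero    = r
  walk-successor (r ∷ w) zero    = r
  walk-successor (r ∷ w) (suc i) = walk-successor w i

  zigzag : List A → List A → List A → List A
  zigzag (a ∷ as) (b ∷ bs) ys = a ∷ b ∷ zigzag as bs ys
  zigzag _        _        ys = ys

  zigzag-length : ∀ as bs ys → length as ≡ length bs → length (zigzag as bs ys) ≡ 2 * length as + length ys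
  zigzag-length []       []       ys eq = refl
  zigzag-length (a ∷ as) (b ∷ bs) ys eq = trans (cong (2 +_) (zigzag-length as bs ys (suc-injective eq)))
    (shift (length as) (length ys))
    where
    shift : ∀ s t → suc (suc (2 * s + t)) ≡ 2 * suc s + t
    shift s t = cong (_+ t) (sym (*-suc 2 s))

  zigzag-All : ∀ {P : A → Set} {as bs ys} → All P as → All P bs → All P ys → All P (zigzag as bs ys)
  zigzag-All []       q        r = r
  zigzag-All (_ ∷ _)  []       r = r
  zigzag-All (p ∷ ps) (q ∷ qs) r = p ∷ q ∷ zigzag-All ps qs r

  zigzag-Unique : ∀ {as bs ys} → Unique as → Unique bs → Unique ys →
    All (λ a → All (a ≢_) bs) as → All (λ a → All (a ≢_) ys) as → All (λ b → All (b ≢_) ys) bs →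
    Unique (zigzag as bs ys)
  zigzag-Unique []       _        w ab ay by = w
  zigzag-Unique (_ ∷ _)  []       w ab ay by = w
  zigzag-Unique (a∉ ∷ u) (b∉ ∷ v) w ((a≢b ∷ a≢bs) ∷ ab) (a≢ys ∷ ay) (b≢ys ∷ by) =
    (a≢b ∷ zigzag-All a∉ a≢bs a≢ys) ∷
    zigzag-All (All.map (λ { (a≢b ∷ _) → a≢b ∘ sym }) ab) b∉ b≢ys ∷
    zigzag-Unique u v w (All.map (λ { (_ ∷ p) → p }) ab) ay by

  -- The walk alternates between the two sides and leaves from whichever b comes last, so all of
  -- `b ∷ bs` are required to be related to `y`.
  zigzag-Walk : ∀ {R : A → A → Set} {z} → Symmetric R → ∀ {b as bs y ys} →
    All (λ a → All (R a) (b ∷ bs)) as → All (λ b → R b y) (b ∷ bs) →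
    Walk R z (y ∷ ys) → Walk R z (b ∷ zigzag as bs (y ∷ ys))
  zigzag-Walk s {as = []}                 _                    (by ∷ _)  w = by ∷ w
  zigzag-Walk s {as = _ ∷ _} {bs = []}    _                    (by ∷ _)  w = by ∷ w
  zigzag-Walk s {as = _ ∷ _} {bs = _ ∷ _} ((ab ∷ ab′ ∷ _) ∷ p) (_ ∷ bys) w =
    s ab ∷ ab′ ∷ zigzag-Walk s (All.map (λ { (_ ∷ q) → q }) p) bys w

-- Kites and the cycles built from them

hasColour : Bool → Maybe Bool → Bool
hasColour true  (just c) = c
hasColour false (just c) = not c
hasColour _     nothing  = false

opposite : Maybe Bool → Maybe Bool → Bool
opposite (just c) m = hasColour (not c) m
opposite nothing  m = false

opposite⇒just : ∀ m m′ → opposite m m′ ≡ true → ∃[ c ] m′ ≡ just c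
opposite⇒just (just true)  (just c) _ = c , refl
opposite⇒just (just false) (just c) _ = c , refl

opposite⇒≢ : ∀ m m′ → opposite m m′ ≡ true → m ≢ m′
opposite⇒≢ (just true)  (just false) _ ()
opposite⇒≢ (just false) (just true)  _ ()

module _ {n : ℕ} (G : BiGraph n) where

  edge : Fin n → Fin n → Bool
  edge i j = hasColour true (adj G i j) ∨ hasColour false (adj G i j)

  Adj : Fin n → Fin n → Set
  Adj i j = ∃[ c ] adj G i j ≡ just c

  Adj-sym : Symmetric Adj
  Adj-sym {i} {j} (c , e) = c , trans (BiGraph.sym G j i) e

  Adj⇒≢ : ∀ {i j} → Adj i j → i ≢ j
  Adj⇒≢ {i} (c , e) refl = contradiction (trans (sym e) (irrefl G i)) λ ()

  edge⇒Adj : ∀ {i j} → edge i j ≡ true → Adj i j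
  edge⇒Adj {i} {j} h with adj G i j
  ... | just c = c , refl

  -- The colouring is read off the walk. Since the edges xy and yz already differ in colour, nothing
  -- has to be known about the colours of the others.
  cycle-from-walk : ∀ x y z xs → Unique (x ∷ y ∷ z ∷ xs) → Walk Adj x (x ∷ y ∷ z ∷ xs) →
    adj G x y ≢ adj G y z → ContainsNonMonoCycle (length (x ∷ y ∷ z ∷ xs)) G
  cycle-from-walk x y z xs uniq walk x≢z =
    col , (zero , suc zero , col≢) , lookup l , lookup-injective uniq , λ i →
      trans (cong (adj G (lookup l i)) (lookup-next x (y ∷ z ∷ xs) i)) (proj₂ (walk-successor walk i))
    where
    l : List (Fin n)
    l = x ∷ y ∷ z ∷ xs
    col : Fin (length l) → Bool
    col i = proj₁ (walk-successor walk i)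
    col≢ : col zero ≢ col (suc zero)
    col≢ eq = x≢z (trans (proj₂ (walk-successor walk zero))
      (trans (cong just eq) (sym (proj₂ (walk-successor walk (suc zero))))))

  -- The vertices `c` and `d` come first, so that `kite c d` is a relation between `a` and `b`. That
  -- `d` differs from `b` follows from the colours, but `c ≢ d` has to be demanded.
  kite : Fin n → Fin n → Fin n → Fin n → Bool
  kite c d a b = (edge a b ∧ edge a c ∧ edge b c) ∧ (opposite (adj G a b) (adj G a d) ∧ not ⌊ c Fin.≟ d ⌋)

  record Kite (c d a b : Fin n) : Set where
    field
      ab : Adj a b
      ac : Adj a c
      bc : Adj b c
      ad : Adj a d
      ab≢ad : adj G a b ≢ adj G a d
      c≢d : c ≢ d

    b≢d : b ≢ d
    b≢d refl = ab≢ad refl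

  kite⇒Kite : ∀ {c d a b} → kite c d a b ≡ true → Kite c d a b
  kite⇒Kite {c} {d} {a} {b} h = record
    { ab = edge⇒Adj (∧-trueˡ triangle)
    ; ac = edge⇒Adj (∧-trueˡ (∧-trueʳ {edge a b} triangle))
    ; bc = edge⇒Adj (∧-trueʳ {edge a c} (∧-trueʳ {edge a b} triangle))
    ; ad = opposite⇒just (adj G a b) (adj G a d) (∧-trueˡ pendant)
    ; ab≢ad = opposite⇒≢ (adj G a b) (adj G a d) (∧-trueˡ pendant)
    ; c≢d = not-equal (∧-trueʳ {opposite (adj G a b) (adj G a d)} pendant) }
    where
    triangle : edge a b ∧ edge a c ∧ edge b c ≡ true
    triangle = ∧-trueˡ h
    pendant : opposite (adj G a b) (adj G a d) ∧ not ⌊ c Fin.≟ d ⌋ ≡ true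
    pendant = ∧-trueʳ {edge a b ∧ edge a c ∧ edge b c} h
    not-equal : not ⌊ c Fin.≟ d ⌋ ≡ true → c ≢ d
    not-equal h with c Fin.≟ d
    not-equal () | yes _
    not-equal h  | no c≢d = c≢d

  -- The cycle runs d a₀ b₀ a₁ b₁ … and closes through a′, with c inserted
  -- before a′ when the length is odd.
  cycle-from-kites : ∀ {c d a′ a₀ as b₀ b₁ bs} → length as ≡ length bs →
    Unique (a′ ∷ a₀ ∷ as) → Unique (b₀ ∷ b₁ ∷ bs) →
    All (λ a → All (Kite c d a) (b₀ ∷ b₁ ∷ bs)) (a′ ∷ a₀ ∷ as) →
    ContainsNonMonoCycle (4 + 2 * length as) G × ContainsNonMonoCycle (5 + 2 * length as) G
  cycle-from-kites {c} {d} {a′} {a₀} {as} {b₀} {b₁} {bs} len ((a′∉ ∷ uₐ)) ((b₀≢b₁ ∷ b₀∉) ∷ (_ ∷ u_b)) kites =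
    subst (λ k → ContainsNonMonoCycle k G) (even-length (length as))
      (subst (λ k → ContainsNonMonoCycle (3 + k) G) (zigzag-length as bs (a′ ∷ []) len)
        (cycle-from-walk d a₀ b₀ (zigzag as bs (a′ ∷ []))
          (d∉ (d≢a′ ∷ []) ∷ uniq ([] ∷ []) (All.map (_∷ []) a≢a′) (All.map (_∷ []) b≢a′))
          (da₀ ∷ a₀b₀ ∷ zigzag-Walk Adj-sym adjacent (All.map Adj-sym a′b) (end a′d))
          d≢))
    , subst (λ k → ContainsNonMonoCycle k G) (odd-length (length as))
      (subst (λ k → ContainsNonMonoCycle (3 + k) G) (zigzag-length as bs (c ∷ a′ ∷ []) len)
        (cycle-from-walk d a₀ b₀ (zigzag as bs (c ∷ a′ ∷ []))
          (d∉ (c≢d ∘ sym ∷ d≢a′ ∷ []) ∷ uniq ((c≢a′ ∷ []) ∷ [] ∷ [])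
            (All.zipWith (λ (p , q) → p ∷ q ∷ []) (a≢c , a≢a′))
            (All.zipWith (λ (p , q) → p ∷ q ∷ []) (b≢c , b≢a′)))
          (da₀ ∷ a₀b₀ ∷ zigzag-Walk Adj-sym adjacent bc (ca′ ∷ end a′d))
          d≢))
    where
    skip : ∀ {P : Fin n → Set} {x y xs} → All P (x ∷ y ∷ xs) → All P (x ∷ xs)
    skip (p ∷ _ ∷ ps) = p ∷ ps
    -- As `a′` is reserved for closing the cycle, dropping `b₁` leaves equally many a's and b's for
    -- the zigzag. With `d` and `a′` the length is 2 + 2(1 + `length as`), and `c` adds one more.
    kites′ : All (λ a → All (Kite c d a) (b₀ ∷ bs)) (a′ ∷ a₀ ∷ as)
    kites′ = All.map skip kites
    kites₀ : All (λ a → All (Kite c d a) (b₀ ∷ bs)) (a₀ ∷ as)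
    kites₀ = All.tail kites′
    k₀₀ : Kite c d a₀ b₀
    k₀₀ = All.head (All.head kites₀)
    k′₀ : Kite c d a′ b₀
    k′₀ = All.head (All.head kites′)
    da₀ : Adj d a₀
    da₀ = Adj-sym (Kite.ad k₀₀)
    a₀b₀ : Adj a₀ b₀
    a₀b₀ = Kite.ab k₀₀
    a′d : Adj a′ d
    a′d = Kite.ad k′₀
    ca′ : Adj c a′
    ca′ = Adj-sym (Kite.ac k′₀)
    c≢d : c ≢ d
    c≢d = Kite.c≢d k₀₀
    c≢a′ : c ≢ a′
    c≢a′ = Adj⇒≢ ca′
    d≢a′ : d ≢ a′
    d≢a′ = Adj⇒≢ a′d ∘ sym
    d≢ : adj G d a₀ ≢ adj G a₀ b₀
    d≢ eq = Kite.ab≢ad k₀₀ (trans (sym eq) (BiGraph.sym G d a₀))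
    a′b : All (Adj a′) (b₀ ∷ bs)
    a′b = All.map Kite.ab (All.head kites′)
    b≢a′ : All (_≢ a′) (b₀ ∷ bs)
    b≢a′ = All.map (λ e → Adj⇒≢ e ∘ sym) a′b
    a≢a′ : All (_≢ a′) (a₀ ∷ as)
    a≢a′ = All.map (_∘ sym) a′∉
    a≢c : All (_≢ c) (a₀ ∷ as)
    a≢c = All.map (λ ks → Adj⇒≢ (Kite.ac (All.head ks))) kites₀
    bc : All (λ b → Adj b c) (b₀ ∷ bs)
    bc = All.map Kite.bc (All.head kites₀)
    b≢c : All (_≢ c) (b₀ ∷ bs)
    b≢c = All.map Adj⇒≢ bc
    adjacent : All (λ a → All (Adj a) (b₀ ∷ bs)) as
    adjacent = All.map (All.map Kite.ab) (All.tail kites₀)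
    d∉ : ∀ {ys} → All (d ≢_) ys → All (d ≢_) (zigzag (a₀ ∷ as) (b₀ ∷ bs) ys)
    d∉ = zigzag-All (All.map (λ ks → Adj⇒≢ (Kite.ad (All.head ks)) ∘ sym) kites₀)
                    (All.map (λ k → Kite.b≢d k ∘ sym) (All.head kites₀))
    uniq : ∀ {ys} → Unique ys → All (λ a → All (a ≢_) ys) (a₀ ∷ as) → All (λ b → All (b ≢_) ys) (b₀ ∷ bs) →
           Unique (zigzag (a₀ ∷ as) (b₀ ∷ bs) ys)
    uniq v = zigzag-Unique uₐ (b₀∉ ∷ u_b) v (All.map (All.map (Adj⇒≢ ∘ Kite.ab)) kites₀)
    even-length : ∀ s → 3 + (2 * s + 1) ≡ 4 + 2 * s
    even-length = solve-∀
    odd-length : ∀ s → 3 + (2 * s + 2) ≡ 5 + 2 * s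
    odd-length = solve-∀

data EvenOrOdd : ℕ → Set where
  even : ∀ s → EvenOrOdd (4 + 2 * s)
  odd  : ∀ s → EvenOrOdd (5 + 2 * s)

evenOrOdd : ∀ k → 4 ≤ k → EvenOrOdd k
evenOrOdd k 4≤k = subst EvenOrOdd (m+[n∸m]≡n 4≤k) (go (k ∸ 4))
  where
  go : ∀ j → EvenOrOdd (4 + j)
  go zero = even 0
  go (suc j) with 4 + j | go j
  ... | _ | even s = odd s
  ... | _ | odd s  = subst EvenOrOdd (shift s) (even (suc s))
    where
    shift : ∀ s → 4 + 2 * suc s ≡ suc (5 + 2 * s)
    shift s = cong (4 +_) (*-suc 2 s)

-- The quadratic inequality

2mn≤m²+n² : ∀ m n → 2 * (m * n) ≤ m * m + n * n
2mn≤m²+n² m n with ≤-total m n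
... | inj₁ m≤n = subst (λ n → 2 * (m * n) ≤ m * m + n * n) (m+[n∸m]≡n m≤n)
                   (≤-trans (m≤m+n _ ((n ∸ m) * (n ∸ m))) (≤-reflexive (expand m (n ∸ m))))
  where
  expand : ∀ m d → 2 * (m * (m + d)) + d * d ≡ m * m + (m + d) * (m + d)
  expand = solve-∀
... | inj₂ n≤m = subst (λ m → 2 * (m * n) ≤ m * m + n * n) (m+[n∸m]≡n n≤m)
                   (≤-trans (m≤m+n _ ((m ∸ n) * (m ∸ n))) (≤-reflexive (expand n (m ∸ n))))
  where
  expand : ∀ n d → 2 * ((n + d) * n) + d * d ≡ (n + d) * (n + d) + n * n
  expand = solve-∀

-- With x = a + a′ + p and y = b + b′ + q and m = m₁ + m₂, the difference of the
-- two sides is 4ab′ + 4a′b + (m₁ − m₂ − a + a′ − b + b′)² plus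
-- 2m(p + q) − (p − q)(2(x − y) − (p − q)); below p = q + r.
quadratic-step : ∀ m₁ m₂ a a′ b b′ q r →
  let x = a + a′ + (q + r) ; y = b + b′ + q ; m = m₁ + m₂ in
  x ≤ y + m →
  2 * (x * x) + 2 * (y * y) + 4 * (m₁ * m₂) + 4 * (m₁ * (a + b)) + 4 * (m₂ * (a′ + b′))
    ≤ (x + y + m) * (x + y + m) + 2 * (a * a + a′ * a′ + b * b + b′ * b′)
quadratic-step m₁ m₂ a a′ b b′ q r x≤y+m =
  +-cancelʳ-≤ (2 * (r * x) + 2 * (P * Q)) _ _ (begin
    lhs + (2 * (r * x) + 2 * (P * Q))
      ≤⟨ +-monoʳ-≤ lhs (+-mono-≤ (*-monoʳ-≤ 2 (*-monoʳ-≤ r x≤y+m)) (2mn≤m²+n² P Q)) ⟩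
    lhs + (2 * (r * (y + m)) + (P * P + Q * Q))
      ≤⟨ m≤m+n _ (4 * (m * q) + r * r + 4 * (a * b′) + 4 * (a′ * b)) ⟩
    lhs + (2 * (r * (y + m)) + (P * P + Q * Q)) + (4 * (m * q) + r * r + 4 * (a * b′) + 4 * (a′ * b))
      ≡⟨ identity m₁ m₂ a a′ b b′ q r ⟩
    rhs + (2 * (r * x) + 2 * (P * Q)) ∎)
  where
  open ≤-Reasoning
  x = a + a′ + (q + r)
  y = b + b′ + q
  m = m₁ + m₂
  P = m₁ + a′ + b′
  Q = m₂ + a + b
  lhs = 2 * (x * x) + 2 * (y * y) + 4 * (m₁ * m₂) + 4 * (m₁ * (a + b)) + 4 * (m₂ * (a′ + b′))
  rhs = (x + y + m) * (x + y + m) + 2 * (a * a + a′ * a′ + b * b + b′ * b′)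
  identity : ∀ m₁ m₂ a a′ b b′ q r →
    2 * ((a + a′ + (q + r)) * (a + a′ + (q + r))) + 2 * ((b + b′ + q) * (b + b′ + q)) +
      4 * (m₁ * m₂) + 4 * (m₁ * (a + b)) + 4 * (m₂ * (a′ + b′))
      + (2 * (r * (b + b′ + q + (m₁ + m₂))) +
         ((m₁ + a′ + b′) * (m₁ + a′ + b′) + (m₂ + a + b) * (m₂ + a + b)))
      + (4 * ((m₁ + m₂) * q) + r * r + 4 * (a * b′) + 4 * (a′ * b))
    ≡ (a + a′ + (q + r) + (b + b′ + q) + (m₁ + m₂)) * (a + a′ + (q + r) + (b + b′ + q) + (m₁ + m₂))
      + 2 * (a * a + a′ * a′ + b * b + b′ * b′)
      + (2 * (r * (a + a′ + (q + r))) + 2 * ((m₁ + a′ + b′) * (m₂ + a + b)))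
  identity = solve-∀

-- In the application `x`, `y`, `m₁`, `m₂` are class sizes; `a`, `a′` are the sizes of X ∩ g and X ∩
-- h, and `b`, `b′` those for Y. The left side, less the squares on the right, is the main term of
-- the bound on 4 e(G). The statement is symmetric in X and Y, so the larger of the surpluses p = x
-- - a - a′ and q = y - b - b′ may be taken first; each order uses one of the last two hypotheses.
quadratic : ∀ m₁ m₂ a a′ b b′ {x y} →
  a + a′ ≤ x → b + b′ ≤ y → x ≤ y + (m₁ + m₂) → y ≤ x + (m₁ + m₂) →
  2 * (x * x) + 2 * (y * y) + 4 * (m₁ * m₂) + 4 * (m₁ * (a + b)) + 4 * (m₂ * (a′ + b′))
    ≤ (x + y + (m₁ + m₂)) * (x + y + (m₁ + m₂)) + 2 * (a * a + a′ * a′ + b * b + b′ * b′)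
quadratic m₁ m₂ a a′ b b′ {x} {y} a≤ b≤ x≤ y≤
  with x ∸ (a + a′) | m+[n∸m]≡n a≤ | y ∸ (b + b′) | m+[n∸m]≡n b≤
... | p | refl | q | refl with ≤-total q p
...   | inj₁ q≤p with p ∸ q | m+[n∸m]≡n q≤p
...     | r | refl = quadratic-step m₁ m₂ a a′ b b′ q r x≤
quadratic m₁ m₂ a a′ b b′ {x} {y} a≤ b≤ x≤ y≤ | p | refl | q | refl | inj₂ p≤q with q ∸ p | m+[n∸m]≡n p≤q
... | r | refl = begin
  _ ≡⟨ swapˡ m₁ m₂ a a′ b b′ (a + a′ + p) (b + b′ + (p + r)) ⟩
  _ ≤⟨ quadratic-step m₁ m₂ b b′ a a′ p r y≤ ⟩
  _ ≡⟨ swapʳ m₁ m₂ a a′ b b′ (a + a′ + p) (b + b′ + (p + r)) ⟩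
  _ ∎
  where
  open ≤-Reasoning
  swapˡ : ∀ m₁ m₂ a a′ b b′ x y →
    2 * (x * x) + 2 * (y * y) + 4 * (m₁ * m₂) + 4 * (m₁ * (a + b)) + 4 * (m₂ * (a′ + b′))
    ≡ 2 * (y * y) + 2 * (x * x) + 4 * (m₁ * m₂) + 4 * (m₁ * (b + a)) + 4 * (m₂ * (b′ + a′))
  swapˡ = solve-∀
  swapʳ : ∀ m₁ m₂ a a′ b b′ x y →
    (y + x + (m₁ + m₂)) * (y + x + (m₁ + m₂)) + 2 * (b * b + b′ * b′ + a * a + a′ * a′)
    ≡ (x + y + (m₁ + m₂)) * (x + y + (m₁ + m₂)) + 2 * (a * a + a′ * a′ + b * b + b′ * b′)
  swapʳ = solve-∀

-- Counting edges between vertex classes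

-- Inequalities between double sums are proved below termwise, and the termwise claims, having
-- finitely many cases, are decided by evaluation.
∀Bool? : ∀ {P : Bool → Set} → (∀ b → Dec (P b)) → Dec (∀ b → P b)
∀Bool? P? with P? true | P? false
... | yes p | yes q = yes λ { true → p ; false → q }
... | no ¬p | _     = no λ h → ¬p (h true)
... | yes _ | no ¬q = no λ h → ¬q (h false)

-- A single classifying function makes the four vertex classes disjoint and exhaustive by
-- construction.
data Class : Set where
  X Y M₁ M₂ : Class

isX isY isM₂ isM₁ isXY : Class → Bool
isX X = true
isX _ = false
isY Y = true
isY _ = false
isM₂ M₂ = true
isM₂ _ = false
isM₁ M₁ = true
isM₁ _ = false
isXY c = isX c ∨ isY c

∀Class? : ∀ {P : Class → Set} → (∀ c → Dec (P c)) → Dec (∀ c → P c)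
∀Class? P? with P? X | P? Y | P? M₂ | P? M₁
... | yes p | yes q | yes r | yes s = yes λ { X → p ; Y → q ; M₂ → r ; M₁ → s }
... | no ¬p | _ | _ | _ = no λ h → ¬p (h X)
... | _ | no ¬p | _ | _ = no λ h → ¬p (h Y)
... | _ | _ | no ¬p | _ = no λ h → ¬p (h M₂)
... | _ | _ | _ | no ¬p = no λ h → ¬p (h M₁)

module _ {n : ℕ} where

  infixr 7 _∩_

  _∩_ : (Fin n → Bool) → (Fin n → Bool) → Fin n → Bool
  (p ∩ q) i = p i ∧ q i

  all : Fin n → Bool
  all _ = true

  none : Fin n → Bool
  none _ = false

  -- Ordered pairs are counted, so for a symmetric loopless `E` an edge inside `p` contributes twice
  -- to `between E p p`.
  between : (Fin n → Fin n → Bool) → (Fin n → Bool) → (Fin n → Bool) → ℕ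
  between E p q = ∑∑ (λ i j → 𝟙 (p i ∧ q j ∧ E i j))

  sum-+-≤ : ∀ {f g : Fin n → ℕ} {s t} → sum f ≤ s → sum g ≤ t → sum (λ i → f i + g i) ≤ s + t
  sum-+-≤ {f} {g} p q = ≤-trans (≤-reflexive (∑-distrib-+ f g)) (+-mono-≤ p q)

  ∑∑-+-≤ : ∀ {f g : Fin n → Fin n → ℕ} {s t} → ∑∑ f ≤ s → ∑∑ g ≤ t → ∑∑ (λ i j → f i j + g i j) ≤ s + t
  ∑∑-+-≤ {f} {g} p q = ≤-trans (≤-reflexive (∑∑-+ f g)) (+-mono-≤ p q)

  #-mono : ∀ {p q : Fin n → Bool} → (∀ i → p i ≡ true → q i ≡ true) → # p ≤ # q
  #-mono {p} {q} h = sum-mono lemma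
    where
    lemma : ∀ i → 𝟙 (p i) ≤ 𝟙 (q i)
    lemma i with p i in pi
    ... | false = z≤n
    ... | true rewrite h i pi = ≤-refl

  between-rows : ∀ E p q → between E p q ≡ sum (λ i → 𝟙 (p i) * # (q ∩ E i))
  between-rows E p q = trans (∑∑-cong (λ i j → 𝟙-∧ (p i) (q j ∧ E i j))) (sum-factor {f = λ i → 𝟙 (p i)} {g = λ i j → 𝟙 (q j ∧ E i j)})

  between-comm : ∀ {E} → (∀ i j → E i j ≡ E j i) → ∀ p q → between E p q ≡ between E q p
  between-comm {E} E-sym p q = trans (∑-comm (λ i j → 𝟙 (p i ∧ q j ∧ E i j)))
    (∑∑-cong λ j i → cong 𝟙 (trans (swap (p i) (q j) (E i j)) (cong (λ e → q j ∧ p i ∧ e) (E-sym i j))))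
    where
    swap : ∀ a b c → a ∧ b ∧ c ≡ b ∧ a ∧ c
    swap = toWitness {a? = ∀Bool? λ _ → ∀Bool? λ _ → ∀Bool? λ _ → _ Bool.≟ _} _

  weighted-rows : ∀ {E p q} k c → (∀ i → p i ≡ true → k * # (q ∩ E i) ≤ c) → k * between E p q ≤ # p * c
  weighted-rows {E} {p} {q} k c h = begin
    k * between E p q                             ≡⟨ cong (k *_) (between-rows E p q) ⟩
    k * sum (λ i → 𝟙 (p i) * # (q ∩ E i))         ≡⟨ *-distribˡ-sum k (λ i → 𝟙 (p i) * # (q ∩ E i)) ⟩
    sum (λ i → k * (𝟙 (p i) * # (q ∩ E i)))       ≤⟨ sum-mono lemma ⟩
    sum (λ i → 𝟙 (p i) * c)                       ≡⟨ *-distribʳ-sum c (λ i → 𝟙 (p i)) ⟨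
    # p * c                                       ∎
    where
    open ≤-Reasoning
    lemma : ∀ i → k * (𝟙 (p i) * # (q ∩ E i)) ≤ 𝟙 (p i) * c
    lemma i with p i in pi
    ... | false = ≤-reflexive (*-zeroʳ k)
    ... | true  = ≤-trans (≤-reflexive (cong (k *_) (+-identityʳ _))) (≤-trans (h i pi) (≤-reflexive (sym (+-identityʳ c))))

  -- Pairs avoiding `p` number at most (n/2)². Rows and columns in `p` hold at most n/J entries
  -- each, hence at most 2n²/J pairs altogether. Multiplying by 4J gives Jn² + 8n².
  sparse-complement : ∀ {E p} J → (∀ i j → E i j ≡ E j i) → (∀ i → p i ≡ true → J * # (E i) ≤ n) →
    2 * # (not ∘ p) ≤ n → J * (4 * between E all all) ≤ (J + 8) * (n * n)
  sparse-complement {E} {p} J E-sym low few = begin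
    J * (4 * S)                              ≤⟨ *-monoʳ-≤ J (*-monoʳ-≤ 4 split) ⟩
    J * (4 * (P * P + (between E p all + between E all p)))
      ≡⟨ cong (λ t → J * (4 * (P * P + (between E p all + t)))) (between-comm E-sym all p) ⟩
    J * (4 * (P * P + (between E p all + between E p all)))
      ≡⟨ expand J P (between E p all) ⟩
    J * (2 * P * (2 * P)) + 8 * (J * between E p all)
      ≤⟨ +-mono-≤ (*-monoʳ-≤ J (*-mono-≤ few few))
                  (*-monoʳ-≤ 8 (≤-trans (weighted-rows {E} {p} {all} J n low) (*-monoˡ-≤ n (#≤n p)))) ⟩
    J * (n * n) + 8 * (n * n)                ≡⟨ *-distribʳ-+ (n * n) J 8 ⟨
    (J + 8) * (n * n)                        ∎
    where
    open ≤-Reasoning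
    S = between E all all
    P = # (not ∘ p)
    pointwise : ∀ a b e → 𝟙 e ≤ 𝟙 (not a) * 𝟙 (not b) + (𝟙 (a ∧ e) + 𝟙 (b ∧ e))
    pointwise = toWitness {a? = ∀Bool? λ _ → ∀Bool? λ _ → ∀Bool? λ _ → _ ≤? _} _
    split : S ≤ P * P + (between E p all + between E all p)
    split = ≤-trans (∑∑-mono (λ i j → pointwise (p i) (p j) (E i j)))
      (∑∑-+-≤ (≤-reflexive (∑∑-* (λ i → 𝟙 (not (p i))) (λ j → 𝟙 (not (p j))))) (∑∑-+-≤ ≤-refl ≤-refl))
    expand : ∀ J P t → J * (4 * (P * P + (t + t))) ≡ J * (2 * P * (2 * P)) + 8 * (J * t)
    expand = solve-∀

  -- Two disjoint sets g and h spanning few edges leave about as many non-edges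
  -- inside p as there are pairs inside p ∩ g and inside p ∩ h.
  inside-bound : ∀ E p g h → (∀ i → g i ∧ h i ≡ false) →
    between E p p + # (p ∩ g) * # (p ∩ g) + # (p ∩ h) * # (p ∩ h) ≤ # p * # p + between E g g + between E h h
  inside-bound E p g h disjoint = begin
    between E p p + # (p ∩ g) * # (p ∩ g) + # (p ∩ h) * # (p ∩ h)
      ≡⟨ cong₂ _+_ (cong (between E p p +_) (∑∑-* (λ i → 𝟙 (p i ∧ g i)) (λ j → 𝟙 (p j ∧ g j))))
                   (∑∑-* (λ i → 𝟙 (p i ∧ h i)) (λ j → 𝟙 (p j ∧ h j))) ⟨
    between E p p + ∑∑ (λ i j → 𝟙 (p i ∧ g i) * 𝟙 (p j ∧ g j)) + ∑∑ (λ i j → 𝟙 (p i ∧ h i) * 𝟙 (p j ∧ h j))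
      ≡⟨ cong (_+ ∑∑ (λ i j → 𝟙 (p i ∧ h i) * 𝟙 (p j ∧ h j)))
           (∑∑-+ (λ i j → 𝟙 (p i ∧ p j ∧ E i j)) (λ i j → 𝟙 (p i ∧ g i) * 𝟙 (p j ∧ g j))) ⟨
    ∑∑ (λ i j → 𝟙 (p i ∧ p j ∧ E i j) + 𝟙 (p i ∧ g i) * 𝟙 (p j ∧ g j)) + ∑∑ (λ i j → 𝟙 (p i ∧ h i) * 𝟙 (p j ∧ h j))
      ≡⟨ ∑∑-+ (λ i j → 𝟙 (p i ∧ p j ∧ E i j) + 𝟙 (p i ∧ g i) * 𝟙 (p j ∧ g j)) (λ i j → 𝟙 (p i ∧ h i) * 𝟙 (p j ∧ h j)) ⟨
    ∑∑ (λ i j → 𝟙 (p i ∧ p j ∧ E i j) + 𝟙 (p i ∧ g i) * 𝟙 (p j ∧ g j) + 𝟙 (p i ∧ h i) * 𝟙 (p j ∧ h j))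
      ≤⟨ ∑∑-mono (λ i j → pointwise (p i) (p j) (g i) (h i) (g j) (h j) (E i j) (disjoint i) (disjoint j)) ⟩
    ∑∑ (λ i j → 𝟙 (p i) * 𝟙 (p j) + 𝟙 (g i ∧ g j ∧ E i j) + 𝟙 (h i ∧ h j ∧ E i j))
      ≤⟨ ∑∑-+-≤ (∑∑-+-≤ (≤-reflexive (∑∑-* (λ i → 𝟙 (p i)) (λ j → 𝟙 (p j)))) ≤-refl) ≤-refl ⟩
    # p * # p + between E g g + between E h h ∎
    where
    open ≤-Reasoning
    pointwise : ∀ pᵢ pⱼ gᵢ hᵢ gⱼ hⱼ e → gᵢ ∧ hᵢ ≡ false → gⱼ ∧ hⱼ ≡ false →
      𝟙 (pᵢ ∧ pⱼ ∧ e) + 𝟙 (pᵢ ∧ gᵢ) * 𝟙 (pⱼ ∧ gⱼ) + 𝟙 (pᵢ ∧ hᵢ) * 𝟙 (pⱼ ∧ hⱼ)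
        ≤ 𝟙 pᵢ * 𝟙 pⱼ + 𝟙 (gᵢ ∧ gⱼ ∧ e) + 𝟙 (hᵢ ∧ hⱼ ∧ e)
    pointwise = toWitness {a? = ∀Bool? λ _ → ∀Bool? λ _ → ∀Bool? λ _ → ∀Bool? λ _ → ∀Bool? λ _ → ∀Bool? λ _ → ∀Bool? λ _ →
      (_ Bool.≟ _) →-dec ((_ Bool.≟ _) →-dec (_ ≤? _))} _

  -- Pairs touching `M₁` are charged to the row or column of an end in `M₁`; the other terms list
  -- the pairs among X, Y and `M₂`.
  between-cover : ∀ {E} → (∀ i j → E i j ≡ E j i) → (cls : Fin n → Class) →
    let x = isX ∘ cls ; y = isY ∘ cls ; m₂ = isM₂ ∘ cls ; m₁ = isM₁ ∘ cls in
    between E all all ≤ between E x x + between E y y + 2 * between E x y + 2 * between E m₁ all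
                        + between E m₂ m₂ + 2 * between E m₂ (isXY ∘ cls)
  between-cover {E} E-sym cls = ≤-trans (∑∑-mono (λ i j → pointwise (cls i) (cls j) (E i j)))
    (∑∑-+-≤ (∑∑-+-≤ (∑∑-+-≤ (∑∑-+-≤ (∑∑-+-≤ ≤-refl ≤-refl) (twice x y)) (twice m₁ all)) ≤-refl) (twice m₂ xy))
    where
    x y m₂ m₁ xy : Fin n → Bool
    x = isX ∘ cls
    y = isY ∘ cls
    m₂ = isM₂ ∘ cls
    m₁ = isM₁ ∘ cls
    xy = isXY ∘ cls
    twice : ∀ p q → ∑∑ (λ i j → 𝟙 (p i ∧ q j ∧ E i j) + 𝟙 (q i ∧ p j ∧ E i j)) ≤ 2 * between E p q
    twice p q = ∑∑-+-≤ {f = λ i j → 𝟙 (p i ∧ q j ∧ E i j)} {g = λ i j → 𝟙 (q i ∧ p j ∧ E i j)} ≤-refl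
      (≤-reflexive (trans (between-comm E-sym q p) (sym (+-identityʳ _))))
    pointwise : ∀ a b e → 𝟙 e ≤
      𝟙 (isX a ∧ isX b ∧ e) + 𝟙 (isY a ∧ isY b ∧ e) + (𝟙 (isX a ∧ isY b ∧ e) + 𝟙 (isY a ∧ isX b ∧ e))
      + (𝟙 (isM₁ a ∧ true ∧ e) + 𝟙 (true ∧ isM₁ b ∧ e)) + 𝟙 (isM₂ a ∧ isM₂ b ∧ e)
      + (𝟙 (isM₂ a ∧ isXY b ∧ e) + 𝟙 (isXY a ∧ isM₂ b ∧ e))
    pointwise = toWitness {a? = ∀Class? λ _ → ∀Class? λ _ → ∀Bool? λ _ → _ ≤? _} _

-- Assembling the class bounds

-- The error 34 N is made up of 8 N from each of `exy`, `ed` and `ec`, 2 N from `ecc`, and 4 N from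
-- each of `Tg` and `Th`, which enter through both X and Y. The squares of `a`, `a′`, `b`, `b′` are
-- added to both sides in place of a subtraction.
combine-bounds : ∀ J N {S exx eyy exy ed ecc ec x y c m a a′ b b′ Tg Th} →
  S ≤ exx + eyy + 2 * exy + 2 * ed + ecc + 2 * ec →
  exx + a * a + a′ * a′ ≤ x * x + Tg + Th →
  eyy + b * b + b′ * b′ ≤ y * y + Tg + Th →
  J * exy ≤ 2 * N →
  J * ed ≤ J * (m * (a + b + c)) + 2 * N →
  ecc ≤ Tg →
  J * ec ≤ J * (c * (a′ + b′)) + 2 * N →
  J * Tg ≤ N → J * Th ≤ N →
  2 * (x * x) + 2 * (y * y) + 4 * (m * c) + 4 * (m * (a + b)) + 4 * (c * (a′ + b′))
    ≤ N + 2 * (a * a + a′ * a′ + b * b + b′ * b′) →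
  J * (2 * S) ≤ (J + 34) * N
combine-bounds J N {S} {exx} {eyy} {exy} {ed} {ecc} {ec} {x} {y} {c} {m} {a} {a′} {b} {b′} {Tg} {Th}
  cover inX inY hxy hd hcc hc hg hh quad =
  +-cancelʳ-≤ (J * (2 * sq)) _ _ (begin
    J * (2 * S) + J * (2 * sq)
      ≤⟨ +-monoˡ-≤ (J * (2 * sq)) (*-monoʳ-≤ J (*-monoʳ-≤ 2 (≤-trans cover (+-monoˡ-≤ (2 * ec) (+-monoʳ-≤ (exx + eyy + 2 * exy + 2 * ed) hcc))))) ⟩
    J * (2 * (exx + eyy + 2 * exy + 2 * ed + Tg + 2 * ec)) + J * (2 * sq)
      ≡⟨ regroup J exx eyy exy ed Tg ec a a′ b b′ ⟩
    2 * (J * ((exx + a * a + a′ * a′) + (eyy + b * b + b′ * b′))) + 4 * (J * exy) + 4 * (J * ed) + 2 * (J * Tg) + 4 * (J * ec)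
      ≤⟨ +-mono-≤ (+-mono-≤ (+-mono-≤ (+-mono-≤ (*-monoʳ-≤ 2 (*-monoʳ-≤ J (+-mono-≤ inX inY))) (*-monoʳ-≤ 4 hxy))
           (*-monoʳ-≤ 4 hd)) (*-monoʳ-≤ 2 hg)) (*-monoʳ-≤ 4 hc) ⟩
    2 * (J * ((x * x + Tg + Th) + (y * y + Tg + Th))) + 4 * (2 * N) + 4 * (J * (m * (a + b + c)) + 2 * N) + 2 * N
      + 4 * (J * (c * (a′ + b′)) + 2 * N)
      ≡⟨ regroup′ J N x y Tg Th m a a′ b b′ c ⟩
    J * (2 * (x * x) + 2 * (y * y) + 4 * (m * c) + 4 * (m * (a + b)) + 4 * (c * (a′ + b′)))
      + 4 * (J * Tg) + 4 * (J * Th) + 26 * N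
      ≤⟨ +-monoˡ-≤ (26 * N) (+-mono-≤ (+-mono-≤ (*-monoʳ-≤ J quad) (*-monoʳ-≤ 4 hg)) (*-monoʳ-≤ 4 hh)) ⟩
    J * (N + 2 * sq) + 4 * N + 4 * N + 26 * N
      ≡⟨ collect J N sq ⟩
    (J + 34) * N + J * (2 * sq) ∎)
  where
  open ≤-Reasoning
  sq = a * a + a′ * a′ + b * b + b′ * b′
  regroup : ∀ J exx eyy exy ed Tg ec a a′ b b′ →
    J * (2 * (exx + eyy + 2 * exy + 2 * ed + Tg + 2 * ec)) + J * (2 * (a * a + a′ * a′ + b * b + b′ * b′))
    ≡ 2 * (J * ((exx + a * a + a′ * a′) + (eyy + b * b + b′ * b′))) + 4 * (J * exy) + 4 * (J * ed) + 2 * (J * Tg) + 4 * (J * ec)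
  regroup = solve-∀
  regroup′ : ∀ J N x y Tg Th m a a′ b b′ c →
    2 * (J * ((x * x + Tg + Th) + (y * y + Tg + Th))) + 4 * (2 * N) + 4 * (J * (m * (a + b + c)) + 2 * N) + 2 * N
      + 4 * (J * (c * (a′ + b′)) + 2 * N)
    ≡ J * (2 * (x * x) + 2 * (y * y) + 4 * (m * c) + 4 * (m * (a + b)) + 4 * (c * (a′ + b′)))
      + 4 * (J * Tg) + 4 * (J * Th) + 26 * N
  regroup′ = solve-∀
  collect : ∀ J N sq → J * (N + 2 * sq) + 4 * N + 4 * N + 26 * N ≡ (J + 34) * N + J * (2 * sq)
  collect = solve-∀

#-split : ∀ {n} (p : Fin n → Bool) {q r : Fin n → Bool} →
          (∀ i → p i ≡ true → q i ∨ r i ≡ true) → # p ≤ # q + # r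
#-split p {q} {r} h = ≤-trans (sum-mono lemma) (≤-reflexive (∑-distrib-+ (λ i → 𝟙 (q i)) (λ i → 𝟙 (r i))))
  where
  lemma : ∀ i → 𝟙 (p i) ≤ 𝟙 (q i) + 𝟙 (r i)
  lemma i with p i | h i
  ... | false | _ = z≤n
  ... | true  | f with q i | r i | f refl
  ...   | true  | _     | _ = s≤s z≤n
  ...   | false | true  | _ = ≤-refl

#-disjoint : ∀ {n} (p : Fin n → Bool) {q r : Fin n → Bool} → (∀ i → q i ∧ r i ≡ false) →
             # (p ∩ q) + # (p ∩ r) ≤ # p
#-disjoint p {q} {r} h = ≤-trans (≤-reflexive (sym (∑-distrib-+ (λ i → 𝟙 (p i ∧ q i)) (λ i → 𝟙 (p i ∧ r i)))))
  (sum-mono (λ i → pointwise (p i) (q i) (r i) (h i)))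
  where
  pointwise : ∀ a b c → b ∧ c ≡ false → 𝟙 (a ∧ b) + 𝟙 (a ∧ c) ≤ 𝟙 a
  pointwise = toWitness {a? = ∀Bool? λ _ → ∀Bool? λ _ → ∀Bool? λ _ → (_ Bool.≟ _) →-dec (_ ≤? _)} _

-- Here z is the small set of mixed vertices that lie in many triangles.
weigh-classes : ∀ {n} J (E : Fin n → Fin n → Bool) (cls : Fin n → Class) (g h z : Fin n → Bool) →
  let x = isX ∘ cls ; y = isY ∘ cls ; m₂ = isM₂ ∘ cls ; m₁ = isM₁ ∘ cls in
  (∀ i j → E i j ≡ E j i) →
  (∀ i → g i ∧ h i ≡ false) →
  (∀ i → m₂ i ≡ true → g i ≡ true) →
  (∀ i → m₁ i ≡ true → g i ≡ true → z i ≡ true) →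
  J * # z ≤ n → J * between E g g ≤ n * n → J * between E h h ≤ n * n →
  J * between E x y ≤ 2 * (n * n) →
  (∀ i → m₁ i ≡ true → # (E i) ≤ # g + n * 𝟙 (z i)) →
  J * between E m₂ (isXY ∘ cls) ≤ J * (# m₂ * (# (x ∩ h) + # (y ∩ h))) + 2 * (n * n) →
  # x ≤ # y + (# m₁ + # m₂) → # y ≤ # x + (# m₁ + # m₂) →
  J * (2 * between E all all) ≤ (J + 34) * (n * n)
weigh-classes {n} J E cls g h z E-sym disjoint M₂⊆g M₁∩g⊆z hz hg hh hxy hd hc x≤ y≤ =
  combine-bounds J (n * n) {x = # x} {y = # y} {c = # m₂} {m = # m₁} {a = # (x ∩ g)} {a′ = # (x ∩ h)} {b = # (y ∩ g)} {b′ = # (y ∩ h)}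
    (between-cover E-sym cls)
    (inside-bound E x g h disjoint) (inside-bound E y g h disjoint)
    hxy M₁-bound M₂-bound hc hg hh
    (≤-trans (quadratic (# m₁) (# m₂) (# (x ∩ g)) (# (x ∩ h)) (# (y ∩ g)) (# (y ∩ h))
               (#-disjoint x disjoint) (#-disjoint y disjoint) x≤ y≤)
             (≤-reflexive (cong₂ _+_ (cong (λ t → t * t) total) refl)))
  where
  open ≤-Reasoning
  x y m₂ m₁ : Fin n → Bool
  x = isX ∘ cls
  y = isY ∘ cls
  m₂ = isM₂ ∘ cls
  m₁ = isM₁ ∘ cls
  total : # x + # y + (# m₁ + # m₂) ≡ n
  total = begin-equality
    # x + # y + (# m₁ + # m₂)
      ≡⟨ cong₂ _+_ (∑-distrib-+ (λ i → 𝟙 (x i)) (λ i → 𝟙 (y i))) (∑-distrib-+ (λ i → 𝟙 (m₁ i)) (λ i → 𝟙 (m₂ i))) ⟨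
    sum (λ i → 𝟙 (x i) + 𝟙 (y i)) + sum (λ i → 𝟙 (m₁ i) + 𝟙 (m₂ i))
      ≡⟨ ∑-distrib-+ (λ i → 𝟙 (x i) + 𝟙 (y i)) (λ i → 𝟙 (m₁ i) + 𝟙 (m₂ i)) ⟨
    sum (λ i → 𝟙 (x i) + 𝟙 (y i) + (𝟙 (m₁ i) + 𝟙 (m₂ i)))
      ≡⟨ sum-cong-≗ (λ i → one (cls i)) ⟩
    sum {n} (λ _ → 1)  ≡⟨ sum-const n 1 ⟩
    n * 1              ≡⟨ *-identityʳ n ⟩
    n                  ∎
    where
    one : ∀ k → 𝟙 (isX k) + 𝟙 (isY k) + (𝟙 (isM₁ k) + 𝟙 (isM₂ k)) ≡ 1
    one = toWitness {a? = ∀Class? λ _ → _ ≟ _} _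
  -- Vertices of `M₁` inside `g` lie in `z`, so they are negligible in the size of `g`.
  g-bound : # g ≤ # (x ∩ g) + # (y ∩ g) + # m₂ + # z
  g-bound = begin
    # g ≤⟨ #-split g {q = λ i → (x i ∧ g i) ∨ (y i ∧ g i) ∨ m₂ i} {r = z} (λ i gi → cases i (cls i) refl gi) ⟩
    # (λ i → (x i ∧ g i) ∨ (y i ∧ g i) ∨ m₂ i) + # z
      ≤⟨ +-monoˡ-≤ (# z) (#-split (λ i → (x i ∧ g i) ∨ (y i ∧ g i) ∨ m₂ i) {q = x ∩ g} {r = λ i → (y i ∧ g i) ∨ m₂ i} (λ _ q → q)) ⟩
    # (x ∩ g) + # (λ i → (y i ∧ g i) ∨ m₂ i) + # z
      ≤⟨ +-monoˡ-≤ (# z) (+-monoʳ-≤ (# (x ∩ g)) (#-split (λ i → (y i ∧ g i) ∨ m₂ i) {q = y ∩ g} {r = m₂} (λ _ q → q))) ⟩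
    # (x ∩ g) + (# (y ∩ g) + # m₂) + # z
      ≡⟨ cong (_+ # z) (+-assoc (# (x ∩ g)) (# (y ∩ g)) (# m₂)) ⟨
    # (x ∩ g) + # (y ∩ g) + # m₂ + # z ∎
    where
    cases : ∀ i k → cls i ≡ k → g i ≡ true → ((x i ∧ g i) ∨ (y i ∧ g i) ∨ m₂ i) ∨ z i ≡ true
    cases i X eq gi rewrite eq | gi = refl
    cases i Y eq gi rewrite eq | gi = refl
    cases i M₂ eq gi rewrite eq = refl
    cases i M₁ eq gi rewrite M₁∩g⊆z i (cong isM₁ eq) gi = Bool.∨-zeroʳ _
  M₁-bound : J * between E m₁ all ≤ J * (# m₁ * (# (x ∩ g) + # (y ∩ g) + # m₂)) + 2 * (n * n)
  M₁-bound = begin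
    J * between E m₁ all
      ≡⟨ cong (J *_) (between-rows E m₁ all) ⟩
    J * sum (λ i → 𝟙 (m₁ i) * # (E i))
      ≤⟨ *-monoʳ-≤ J (≤-trans (sum-mono row) (sum-+-≤ {f = λ i → 𝟙 (m₁ i) * # g} {g = λ i → n * 𝟙 (z i)} ≤-refl ≤-refl)) ⟩
    J * (sum (λ i → 𝟙 (m₁ i) * # g) + sum (λ i → n * 𝟙 (z i)))
      ≡⟨ cong (J *_) (cong₂ _+_ (*-distribʳ-sum (# g) (λ i → 𝟙 (m₁ i))) (*-distribˡ-sum n (λ i → 𝟙 (z i)))) ⟨
    J * (# m₁ * # g + n * # z)
      ≤⟨ *-monoʳ-≤ J (+-monoˡ-≤ (n * # z) (*-monoʳ-≤ (# m₁) g-bound)) ⟩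
    J * (# m₁ * (# (x ∩ g) + # (y ∩ g) + # m₂ + # z) + n * # z)
      ≡⟨ expand J (# m₁) (# (x ∩ g) + # (y ∩ g) + # m₂) (# z) n ⟩
    J * (# m₁ * (# (x ∩ g) + # (y ∩ g) + # m₂)) + (# m₁ * (J * # z) + n * (J * # z))
      ≤⟨ +-monoʳ-≤ (J * (# m₁ * (# (x ∩ g) + # (y ∩ g) + # m₂))) (+-mono-≤ (*-mono-≤ (#≤n m₁) hz) (*-monoʳ-≤ n hz)) ⟩
    J * (# m₁ * (# (x ∩ g) + # (y ∩ g) + # m₂)) + (n * n + n * n)
      ≡⟨ cong (J * (# m₁ * (# (x ∩ g) + # (y ∩ g) + # m₂)) +_) (cong (n * n +_) (+-identityʳ (n * n))) ⟨
    J * (# m₁ * (# (x ∩ g) + # (y ∩ g) + # m₂)) + 2 * (n * n) ∎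
    where
    row : ∀ i → 𝟙 (m₁ i) * # (E i) ≤ 𝟙 (m₁ i) * # g + n * 𝟙 (z i)
    row i with m₁ i in di
    ... | false = z≤n
    ... | true  = ≤-trans (≤-reflexive (*-identityˡ (# (E i)))) (≤-trans (hd i di)
                    (≤-reflexive (cong (_+ n * 𝟙 (z i)) (sym (*-identityˡ (# g))))))
    expand : ∀ J m₁ t z n → J * (m₁ * (t + z) + n * z) ≡ J * (m₁ * t) + (m₁ * (J * z) + n * (J * z))
    expand = solve-∀
  M₂-bound : between E m₂ m₂ ≤ between E g g
  M₂-bound = ∑∑-mono (λ i j → pointwise (m₂ i) (m₂ j) (g i) (g j) (E i j) (M₂⊆g i) (M₂⊆g j))
    where
    pointwise : ∀ a b p q e → (a ≡ true → p ≡ true) → (b ≡ true → q ≡ true) → 𝟙 (a ∧ b ∧ e) ≤ 𝟙 (p ∧ q ∧ e)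
    pointwise = toWitness {a? = ∀Bool? λ _ → ∀Bool? λ _ → ∀Bool? λ _ → ∀Bool? λ _ → ∀Bool? λ _ →
      ((_ Bool.≟ _) →-dec (_ Bool.≟ _)) →-dec (((_ Bool.≟ _) →-dec (_ Bool.≟ _)) →-dec (_ ≤? _))} _

-- Choosing sparse neighbourhoods in a balanced graph

⌊⌋-true : ∀ {P : Set} (P? : Dec P) → ⌊ P? ⌋ ≡ true → P
⌊⌋-true (yes p) _ = p

⌊⌋-false : ∀ {P : Set} (P? : Dec P) → ⌊ P? ⌋ ≡ false → ¬ P
⌊⌋-false (no ¬p) _ = ¬p

-- The chosen set is the neighbourhood of a vertex of `p` with most neighbours in `q`, and `Pr`
-- records the sparsity available for such neighbourhoods. If `p` has no vertex, the empty set
-- serves and the maximality is vacuous.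
select : ∀ {n} (E : Fin n → Fin n → Bool) (p q : Fin n → Bool) (Pr : (Fin n → Bool) → Set) →
  Pr none → (∀ v → p v ≡ true → Pr (E v)) →
  ∃[ g ] Pr g × (∀ v → p v ≡ true → # (q ∩ E v) ≤ # (q ∩ g))
select E p q Pr empty nbhd with argmax p (λ v → # (q ∩ E v))
... | inj₁ no-p         = none , empty , λ v pv → contradiction (trans (sym pv) (no-p v)) λ ()
... | inj₂ (u , pu , m) = E u , nbhd u pu , m

between-none : ∀ {n} (E : Fin n → Fin n → Bool) → between E none none ≡ 0
between-none {n} E = trans (∑∑-* {n} (λ _ → 0) (λ _ → 0)) (cong (_* sum {n} (λ _ → 0)) (trans (sum-const n 0) (*-zeroʳ n)))

between-monoˡ : ∀ {n} (E : Fin n → Fin n → Bool) {p p′ : Fin n → Bool} (q : Fin n → Bool) →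
  (∀ i → p i ≡ true → p′ i ≡ true) → between E p q ≤ between E p′ q
between-monoˡ E {p} {p′} q h = ∑∑-mono (λ i j → pointwise (p i) (p′ i) (q j ∧ E i j) (h i))
  where
  pointwise : ∀ a b e → (a ≡ true → b ≡ true) → 𝟙 (a ∧ e) ≤ 𝟙 (b ∧ e)
  pointwise = toWitness {a? = ∀Bool? λ _ → ∀Bool? λ _ → ∀Bool? λ _ → ((_ Bool.≟ _) →-dec (_ Bool.≟ _)) →-dec (_ ≤? _)} _

heavy-rows : ∀ {n} {E : Fin n → Fin n → Bool} {p q : Fin n → Bool} k c →
  (∀ i → p i ≡ true → c ≤ k * # (q ∩ E i)) → # p * c ≤ k * between E p q
heavy-rows {E = E} {p} {q} k c h = begin
  # p * c                                       ≡⟨ *-distribʳ-sum c (λ i → 𝟙 (p i)) ⟩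
  sum (λ i → 𝟙 (p i) * c)                       ≤⟨ sum-mono lemma ⟩
  sum (λ i → k * (𝟙 (p i) * # (q ∩ E i)))       ≡⟨ *-distribˡ-sum k (λ i → 𝟙 (p i) * # (q ∩ E i)) ⟨
  k * sum (λ i → 𝟙 (p i) * # (q ∩ E i))         ≡⟨ cong (k *_) (between-rows E p q) ⟨
  k * between E p q                             ∎
  where
  open ≤-Reasoning
  lemma : ∀ i → 𝟙 (p i) * c ≤ k * (𝟙 (p i) * # (q ∩ E i))
  lemma i with p i in pi
  ... | false = z≤n
  ... | true  = ≤-trans (≤-reflexive (+-identityʳ c)) (≤-trans (h i pi) (≤-reflexive (cong (k *_) (sym (+-identityʳ _)))))

module _ {n : ℕ} (J : ℕ) (R B : Fin n → Fin n → Bool) where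

  Union : Fin n → Fin n → Bool
  Union i j = R i j ∨ B i j

  rich : (Fin n → Fin n → Bool) → Fin n → Bool
  rich M v = ⌊ n ≤? J * # (M v) ⌋

  -- The threshold is n²/J² rather than n²/J: a set spanning at most n²/J² ordered adjacent pairs
  -- has at most n/J vertices with more than n/J neighbours in it.
  triangular : Fin n → Bool
  triangular v = ⌊ n * n <? J * J * between Union (Union v) (Union v) ⌋

  -- A vertex poor in both colours is put into X. A mixed vertex in many triangles goes to `M₁` even
  -- inside `g`, so that every vertex of `M₂` has a sparse neighbourhood.
  classify : Bool → Bool → Bool → Bool → Class
  classify richB richR g t =
    if not richB then X else if not richR then Y else if g ∧ not t then M₂ else M₁

  balanced-bound : 0 < n → 0 < J → (∀ i j → R i j ≡ R j i) → (∀ i j → B i j ≡ B j i) →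
    between Union all all ≤ 2 * between R all all →
    between Union all all ≤ 2 * between B all all →
    J * # (λ v → rich B v ∧ rich R v ∧ triangular v) ≤ n →
    J * (2 * between Union all all) ≤ (J + 34) * (n * n)
  balanced-bound 0<n 0<J R-sym B-sym balR balB few
    -- The set `g` is the neighbourhood of a mixed, non-triangular vertex; with `all` as the counted
    -- set, plain degree is maximised.
    with select Union (λ v → rich B v ∧ rich R v ∧ not (triangular v)) all
      (λ g → J * J * between Union g g ≤ n * n)
      (≤-trans (≤-reflexive (trans (cong (J * J *_) (between-none Union)) (*-zeroʳ (J * J)))) z≤n)
      (λ v h → ≮⇒≥ (⌊⌋-false (n * n <? J * J * between Union (Union v) (Union v)) (third (rich B v) (rich R v) (triangular v) h)))
    where
    third : ∀ a b t → a ∧ b ∧ not t ≡ true → t ≡ false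
    third = toWitness {a? = ∀Bool? λ _ → ∀Bool? λ _ → ∀Bool? λ _ → (_ Bool.≟ _) →-dec (_ Bool.≟ _)} _
  ... | g , g-sparse , g-max = conclude (# x ≤? # y + (# m₁ + # m₂)) (# y ≤? # x + (# m₁ + # m₂))
    where
    open ≤-Reasoning
    E : Fin n → Fin n → Bool
    E = Union
    E-sym : ∀ i j → E i j ≡ E j i
    E-sym i j = cong₂ _∨_ (R-sym i j) (B-sym i j)
    cls : Fin n → Class
    cls v = classify (rich B v) (rich R v) (g v) (triangular v)
    x y m₂ m₁ xy z : Fin n → Bool
    x = isX ∘ cls
    y = isY ∘ cls
    m₂ = isM₂ ∘ cls
    m₁ = isM₁ ∘ cls
    xy = isXY ∘ cls
    z v = rich B v ∧ rich R v ∧ triangular v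

    X⇒ : ∀ a b g t → isX (classify a b g t) ≡ true → a ≡ false
    X⇒ = toWitness {a? = ∀Bool? λ _ → ∀Bool? λ _ → ∀Bool? λ _ → ∀Bool? λ _ → (_ Bool.≟ _) →-dec (_ Bool.≟ _)} _
    Y⇒ : ∀ a b g t → isY (classify a b g t) ≡ true → b ≡ false
    Y⇒ = toWitness {a? = ∀Bool? λ _ → ∀Bool? λ _ → ∀Bool? λ _ → ∀Bool? λ _ → (_ Bool.≟ _) →-dec (_ Bool.≟ _)} _
    M₂⇒ : ∀ a b g t → isM₂ (classify a b g t) ≡ true → g ≡ true
    M₂⇒ = toWitness {a? = ∀Bool? λ _ → ∀Bool? λ _ → ∀Bool? λ _ → ∀Bool? λ _ → (_ Bool.≟ _) →-dec (_ Bool.≟ _)} _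
    M₁∩g⇒ : ∀ a b g t → isM₁ (classify a b g t) ≡ true → g ≡ true → a ∧ b ∧ t ≡ true
    M₁∩g⇒ = toWitness {a? = ∀Bool? λ _ → ∀Bool? λ _ → ∀Bool? λ _ → ∀Bool? λ _ →
      (_ Bool.≟ _) →-dec ((_ Bool.≟ _) →-dec (_ Bool.≟ _))} _
    M₁⇒ : ∀ a b g t → isM₁ (classify a b g t) ≡ true → (a ∧ b ∧ t ≡ true) ⊎ (a ∧ b ∧ not t ≡ true)
    M₁⇒ = toWitness {a? = ∀Bool? λ _ → ∀Bool? λ _ → ∀Bool? λ _ → ∀Bool? λ _ →
      (_ Bool.≟ _) →-dec ((_ Bool.≟ _) ⊎-dec (_ Bool.≟ _))} _

    x-poor : ∀ v → x v ≡ true → J * # (B v) ≤ n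
    x-poor v h = <⇒≤ (≰⇒> (⌊⌋-false (n ≤? J * # (B v)) (X⇒ _ (rich R v) (g v) (triangular v) h)))
    y-poor : ∀ v → y v ≡ true → J * # (R v) ≤ n
    y-poor v h = <⇒≤ (≰⇒> (⌊⌋-false (n ≤? J * # (R v)) (Y⇒ (rich B v) _ (g v) (triangular v) h)))

    shrink : ∀ {t} → J * J * t ≤ n * n → J * t ≤ n * n
    shrink {t} h = ≤-trans (≤-trans (*-monoʳ-≤ J (m≤n*m t J {{>-nonZero 0<J}})) (≤-reflexive (sym (*-assoc J J t)))) h

    -- Only vertices with at most n/J neighbours in `g` compete for w, so that deleting `g` from
    -- N(w) costs little.
    close : Fin n → Bool
    close v = ⌊ J * # (g ∩ E v) ≤? n ⌋

    second = select E (m₂ ∩ close) xy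
      (λ h → J * between E h h ≤ n * n × J * # (g ∩ h) ≤ n)
      ( ≤-trans (≤-reflexive (trans (cong (J *_) (between-none E)) (*-zeroʳ J))) z≤n
      , ≤-trans (*-monoʳ-≤ J (sum-mono {g = λ _ → 0} (λ i → ≤-reflexive (cong 𝟙 (Bool.∧-zeroʳ (g i))))))
          (≤-trans (≤-reflexive (trans (cong (J *_) (trans (sum-const n 0) (*-zeroʳ n))) (*-zeroʳ J))) z≤n) )
      (λ v h → shrink (≮⇒≥ (⌊⌋-false (n * n <? J * J * between E (E v) (E v)) (M₂⇒t (rich B v) (rich R v) (g v) (triangular v) (∧-trueˡ h))))
             , ⌊⌋-true (J * # (g ∩ E v) ≤? n) (∧-trueʳ {m₂ v} h))
      where
      M₂⇒t : ∀ a b g t → isM₂ (classify a b g t) ≡ true → t ≡ false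
      M₂⇒t = toWitness {a? = ∀Bool? λ _ → ∀Bool? λ _ → ∀Bool? λ _ → ∀Bool? λ _ → (_ Bool.≟ _) →-dec (_ Bool.≟ _)} _
    h₀ h : Fin n → Bool
    h₀ = proj₁ second
    -- Here `h₀` is N(w). Disjointness from `g` is what allows non-edges inside `g` and inside `h`
    -- to be counted separately.
    h v = not (g v) ∧ h₀ v
    h₀-sparse : J * between E h₀ h₀ ≤ n * n
    h₀-sparse = proj₁ (proj₁ (proj₂ second))
    h₀-close : J * # (g ∩ h₀) ≤ n
    h₀-close = proj₂ (proj₁ (proj₂ second))
    h₀-max : ∀ v → (m₂ ∩ close) v ≡ true → # (xy ∩ E v) ≤ # (xy ∩ h₀)
    h₀-max = proj₂ (proj₂ second)

    h-sparse : J * between E h h ≤ n * n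
    h-sparse = ≤-trans (*-monoʳ-≤ J (∑∑-mono (λ i j → pointwise (g i) (h₀ i) (g j) (h₀ j) (E i j)))) h₀-sparse
      where
      pointwise : ∀ a b p q e → 𝟙 ((not a ∧ b) ∧ (not p ∧ q) ∧ e) ≤ 𝟙 (b ∧ q ∧ e)
      pointwise = toWitness {a? = ∀Bool? λ _ → ∀Bool? λ _ → ∀Bool? λ _ → ∀Bool? λ _ → ∀Bool? λ _ → _ ≤? _} _

    disjoint : ∀ i → g i ∧ h i ≡ false
    disjoint i = lemma (g i) (h₀ i)
      where
      lemma : ∀ a b → a ∧ (not a ∧ b) ≡ false
      lemma = toWitness {a? = ∀Bool? λ _ → ∀Bool? λ _ → _ Bool.≟ _} _

    -- A vertex of `M₁` outside `z` took part in the choice of `g`, so its degree is at most the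
    -- size of `g`; on `z` the trivial bound n is used.
    M₁-degree : ∀ i → m₁ i ≡ true → # (E i) ≤ # g + n * 𝟙 (z i)
    M₁-degree i di with M₁⇒ (rich B i) (rich R i) (g i) (triangular i) di
    ... | inj₁ zi rewrite zi = ≤-trans (#≤n (E i)) (≤-trans (≤-reflexive (sym (*-identityʳ n))) (m≤n+m _ (# g)))
    ... | inj₂ good = ≤-trans (g-max i good) (m≤m+n _ _)

    -- Blue edges are counted from their ends in X and red ones from their ends in Y; each end sees
    -- at most n/J of them.
    XY-sparse : J * between E x y ≤ 2 * (n * n)
    XY-sparse = begin
      J * between E x y
        ≤⟨ *-monoʳ-≤ J (≤-trans (∑∑-mono (λ i j → pointwise (x i) (y j) (R i j) (B i j)))
             (∑∑-+-≤ {f = λ i j → 𝟙 (x i ∧ y j ∧ B i j)} {g = λ i j → 𝟙 (x i ∧ y j ∧ R i j)} ≤-refl ≤-refl)) ⟩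
      J * (between B x y + between R x y)
        ≡⟨ cong (λ t → J * (between B x y + t)) (between-comm R-sym x y) ⟩
      J * (between B x y + between R y x)
        ≡⟨ *-distribˡ-+ J (between B x y) (between R y x) ⟩
      J * between B x y + J * between R y x
        ≤⟨ +-mono-≤ (weighted-rows {E = B} {p = x} {q = y} J n (λ i xi → ≤-trans (*-monoʳ-≤ J (#-mono {p = y ∩ B i} (λ j q → ∧-trueʳ {y j} q))) (x-poor i xi)))
                    (weighted-rows {E = R} {p = y} {q = x} J n (λ i yi → ≤-trans (*-monoʳ-≤ J (#-mono {p = x ∩ R i} (λ j q → ∧-trueʳ {x j} q))) (y-poor i yi))) ⟩
      # x * n + # y * n
        ≤⟨ +-mono-≤ (*-monoˡ-≤ n (#≤n x)) (≤-trans (*-monoˡ-≤ n (#≤n y)) (m≤m+n (n * n) 0)) ⟩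
      2 * (n * n) ∎
      where
      pointwise : ∀ a b r s → 𝟙 (a ∧ b ∧ (r ∨ s)) ≤ 𝟙 (a ∧ b ∧ s) + 𝟙 (a ∧ b ∧ r)
      pointwise = toWitness {a? = ∀Bool? λ _ → ∀Bool? λ _ → ∀Bool? λ _ → ∀Bool? λ _ → _ ≤? _} _

    far : Fin n → Bool
    far v = m₂ v ∧ not (close v)

    -- Each far vertex lies in `g` and has more than n/J neighbours there, while `g` spans at most
    -- n²/J² ordered pairs.
    few-far : J * # far ≤ n
    few-far = *-cancelˡ-≤ n {{>-nonZero 0<n}} (begin
      n * (J * # far)                ≡⟨ rotate n J (# far) ⟩
      J * (# far * n)                ≤⟨ *-monoʳ-≤ J (heavy-rows {E = E} {p = far} {q = g} J n (λ v h →
                                          <⇒≤ (≰⇒> (⌊⌋-false (J * # (g ∩ E v) ≤? n) (not-true (∧-trueʳ {m₂ v} h)))))) ⟩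
      J * (J * between E far g)      ≤⟨ *-monoʳ-≤ J (*-monoʳ-≤ J (between-monoˡ E g (λ v h → M₂⇒ (rich B v) (rich R v) (g v) (triangular v) (∧-trueˡ h)))) ⟩
      J * (J * between E g g)        ≡⟨ *-assoc J J (between E g g) ⟨
      J * J * between E g g          ≤⟨ g-sparse ⟩
      n * n                          ∎)
      where
      rotate : ∀ n J f → n * (J * f) ≡ J * (f * n)
      rotate = solve-∀
      not-true : ∀ {b} → not b ≡ true → b ≡ false
      not-true {false} _ = refl

    s : ℕ
    s = # (x ∩ h) + # (y ∩ h)

    -- By the choice of w, v has at most as many neighbours in X ∪ Y as w; those of w outside `h`
    -- lie in `g`, and there are at most n/J of them.
    close-degree : ∀ v → (m₂ ∩ close) v ≡ true → J * # (xy ∩ E v) ≤ J * s + n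
    close-degree v cv = begin
      J * # (xy ∩ E v)           ≤⟨ *-monoʳ-≤ J (h₀-max v cv) ⟩
      J * # (xy ∩ h₀)            ≤⟨ *-monoʳ-≤ J (sum-mono (λ i → pointwise (cls i) (g i) (h₀ i))) ⟩
      J * sum (λ i → 𝟙 (x i ∧ h i) + 𝟙 (y i ∧ h i) + 𝟙 (g i ∧ h₀ i))
        ≤⟨ *-monoʳ-≤ J (sum-+-≤ {f = λ i → 𝟙 (x i ∧ h i) + 𝟙 (y i ∧ h i)} {g = λ i → 𝟙 (g i ∧ h₀ i)}
             (sum-+-≤ {f = λ i → 𝟙 (x i ∧ h i)} {g = λ i → 𝟙 (y i ∧ h i)} ≤-refl ≤-refl) ≤-refl) ⟩
      J * (s + # (g ∩ h₀))       ≡⟨ *-distribˡ-+ J s (# (g ∩ h₀)) ⟩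
      J * s + J * # (g ∩ h₀)     ≤⟨ +-monoʳ-≤ (J * s) h₀-close ⟩
      J * s + n                  ∎
      where
      pointwise : ∀ k a b → 𝟙 (isXY k ∧ b) ≤ 𝟙 (isX k ∧ (not a ∧ b)) + 𝟙 (isY k ∧ (not a ∧ b)) + 𝟙 (a ∧ b)
      pointwise = toWitness {a? = ∀Class? λ _ → ∀Bool? λ _ → ∀Bool? λ _ → _ ≤? _} _

    -- Close vertices obey `close-degree`. The far ones number at most n/J and get the trivial
    -- bound, so each of the two groups adds an error of at most n²/J.
    M₂-degree : J * between E m₂ xy ≤ J * (# m₂ * s) + 2 * (n * n)
    M₂-degree = begin
      J * between E m₂ xy
        ≤⟨ *-monoʳ-≤ J (≤-trans (∑∑-mono (λ i j → pointwise (m₂ i) (close i) (xy j ∧ E i j)))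
             (∑∑-+-≤ {f = λ i j → 𝟙 ((m₂ i ∧ close i) ∧ xy j ∧ E i j)} {g = λ i j → 𝟙 (far i ∧ xy j ∧ E i j)} ≤-refl ≤-refl)) ⟩
      J * (between E (m₂ ∩ close) xy + between E far xy)
        ≡⟨ *-distribˡ-+ J (between E (m₂ ∩ close) xy) (between E far xy) ⟩
      J * between E (m₂ ∩ close) xy + J * between E far xy
        ≤⟨ +-mono-≤ (weighted-rows {E = E} {p = m₂ ∩ close} {q = xy} J (J * s + n) close-degree)
                    (weighted-rows {E = E} {p = far} {q = xy} J (J * n) (λ v _ → *-monoʳ-≤ J (#≤n (xy ∩ E v)))) ⟩
      # (m₂ ∩ close) * (J * s + n) + # far * (J * n)
        ≤⟨ +-monoˡ-≤ (# far * (J * n)) (*-monoˡ-≤ (J * s + n) (#-mono {p = m₂ ∩ close} (λ _ → ∧-trueˡ))) ⟩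
      # m₂ * (J * s + n) + # far * (J * n)
        ≡⟨ expand (# m₂) J s n (# far) ⟩
      J * (# m₂ * s) + (# m₂ * n + J * # far * n)
        ≤⟨ +-monoʳ-≤ (J * (# m₂ * s)) (+-mono-≤ (*-monoˡ-≤ n (#≤n m₂)) (≤-trans (*-monoˡ-≤ n few-far) (m≤m+n (n * n) 0))) ⟩
      J * (# m₂ * s) + 2 * (n * n) ∎
      where
      expand : ∀ m₂ J s n f → m₂ * (J * s + n) + f * (J * n) ≡ J * (m₂ * s) + (m₂ * n + J * f * n)
      expand = solve-∀
      pointwise : ∀ a b e → 𝟙 (a ∧ e) ≤ 𝟙 ((a ∧ b) ∧ e) + 𝟙 ((a ∧ not b) ∧ e)
      pointwise = toWitness {a? = ∀Bool? λ _ → ∀Bool? λ _ → ∀Bool? λ _ → _ ≤? _} _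

    -- Colour `M` lives essentially on the complement of `p`, at most n/2 vertices, which gives
    -- about n²/4 ordered pairs. Balancedness then bounds all edges by twice the edges of this
    -- colour.
    one-colour : ∀ {M p} → (∀ i j → M i j ≡ M j i) → (∀ v → p v ≡ true → J * # (M v) ≤ n) →
      between E all all ≤ 2 * between M all all → # (not ∘ p) ≤ # p →
      J * (2 * between E all all) ≤ (J + 34) * (n * n)
    one-colour {M} {p} M-sym poor bal half = begin
      J * (2 * between E all all)        ≤⟨ *-monoʳ-≤ J (*-monoʳ-≤ 2 bal) ⟩
      J * (2 * (2 * between M all all))  ≡⟨ cong (J *_) (*-assoc 2 2 (between M all all)) ⟨
      J * (4 * between M all all)        ≤⟨ sparse-complement {E = M} {p = p} J M-sym poor at-most-half ⟩
      (J + 8) * (n * n)                  ≤⟨ *-monoˡ-≤ (n * n) (+-monoʳ-≤ J (m≤m+n 8 26)) ⟩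
      (J + 34) * (n * n)                 ∎
      where
      at-most-half : 2 * # (not ∘ p) ≤ n
      at-most-half = begin
        # (not ∘ p) + (# (not ∘ p) + 0)  ≤⟨ +-mono-≤ half (≤-reflexive (+-identityʳ _)) ⟩
        # p + # (not ∘ p)                ≡⟨ ∑-distrib-+ (λ i → 𝟙 (p i)) (λ i → 𝟙 (not (p i))) ⟨
        sum (λ i → 𝟙 (p i) + 𝟙 (not (p i))) ≤⟨ sum-bound 1 (λ i → pointwise (p i)) ⟩
        n * 1                            ≡⟨ *-identityʳ n ⟩
        n                                ∎
        where
        pointwise : ∀ b → 𝟙 b + 𝟙 (not b) ≤ 1
        pointwise = toWitness {a? = ∀Bool? λ _ → _ ≤? _} _

    conclude : Dec (# x ≤ # y + (# m₁ + # m₂)) → Dec (# y ≤ # x + (# m₁ + # m₂)) →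
      J * (2 * between E all all) ≤ (J + 34) * (n * n)
    conclude (yes x≤) (yes y≤) = weigh-classes J E cls g h z E-sym disjoint
      (λ v → M₂⇒ (rich B v) (rich R v) (g v) (triangular v))
      (λ v → M₁∩g⇒ (rich B v) (rich R v) (g v) (triangular v))
      few (shrink g-sparse) h-sparse XY-sparse M₁-degree M₂-degree x≤ y≤
    conclude (no x≰) _ = one-colour B-sym x-poor balB (≤-trans outside (<⇒≤ (≰⇒> x≰)))
      where
      outside : # (not ∘ x) ≤ # y + (# m₁ + # m₂)
      outside = ≤-trans (sum-mono (λ i → pointwise (cls i)))
        (sum-+-≤ {f = λ i → 𝟙 (y i)} ≤-refl (sum-+-≤ {f = λ i → 𝟙 (m₁ i)} ≤-refl ≤-refl))
        where
        pointwise : ∀ k → 𝟙 (not (isX k)) ≤ 𝟙 (isY k) + (𝟙 (isM₁ k) + 𝟙 (isM₂ k))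
        pointwise = toWitness {a? = ∀Class? λ _ → _ ≤? _} _
    conclude (yes _) (no y≰) = one-colour R-sym y-poor balR (≤-trans outside (<⇒≤ (≰⇒> y≰)))
      where
      outside : # (not ∘ y) ≤ # x + (# m₁ + # m₂)
      outside = ≤-trans (sum-mono (λ i → pointwise (cls i)))
        (sum-+-≤ {f = λ i → 𝟙 (x i)} ≤-refl (sum-+-≤ {f = λ i → 𝟙 (m₁ i)} ≤-refl ≤-refl))
        where
        pointwise : ∀ k → 𝟙 (not (isY k)) ≤ 𝟙 (isX k) + (𝟙 (isM₁ k) + 𝟙 (isM₂ k))
        pointwise = toWitness {a? = ∀Class? λ _ → _ ≤? _} _

-- Counting kites

𝟙-* : ∀ b {c k} → (b ≡ true → c ≤ k) → 𝟙 b * c ≤ k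
𝟙-* false     h = z≤n
𝟙-* true  {c} h = ≤-trans (≤-reflexive (+-identityʳ c)) (h refl)

list-sum : ∀ {n} (f : Fin n → ℕ) → ListAction.sum (List.map f (allFin n)) ≡ sum f
list-sum {n} f = trans (cong ListAction.sum (map-tabulate id f)) (go f)
  where
  go : ∀ {n} (f : Fin n → ℕ) → ListAction.sum (List.tabulate f) ≡ sum f
  go {zero}  f = refl
  go {suc n} f = cong (f zero +_) (go (f ∘ suc))

twice-pairSum : ∀ {n} (f : Fin n → Fin n → ℕ) → (∀ i j → f i j ≡ f j i) → (∀ i → f i i ≡ 0) →
                2 * pairSum f ≡ ∑∑ f
twice-pairSum {n} f f-sym f-diag = begin-equality
  2 * pairSum f              ≡⟨ cong (2 *_) (trans (list-sum {n} (λ i → ListAction.sum (List.map (up i) (allFin n)))) (sum-cong-≗ (λ i → list-sum (up i)))) ⟩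
  ∑∑ up + (∑∑ up + 0)        ≡⟨ cong (∑∑ up +_) (trans (+-identityʳ _) (∑-comm up)) ⟩
  ∑∑ up + ∑∑ (λ i j → up j i) ≡⟨ ∑∑-+ up (λ i j → up j i) ⟨
  ∑∑ (λ i j → up i j + up j i) ≡⟨ ∑∑-cong pointwise ⟩
  ∑∑ f                       ∎
  where
  open ≤-Reasoning
  up : Fin n → Fin n → ℕ
  up i j = if toℕ i <ᵇ toℕ j then f i j else 0
  pointwise : ∀ i j → up i j + up j i ≡ f i j
  pointwise i j with toℕ i <ᵇ toℕ j in i<j | toℕ j <ᵇ toℕ i in j<i
  ... | true  | false = +-identityʳ (f i j)
  ... | false | true  = f-sym j i
  ... | true  | true  = contradiction (<ᵇ⇒< (toℕ j) (toℕ i) (subst T (sym j<i) tt))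
                          (<-asym (<ᵇ⇒< (toℕ i) (toℕ j) (subst T (sym i<j) tt)))
  ... | false | false = sym (subst (λ j → f i j ≡ 0) i≡j (f-diag i))
    where
    ≮ : ∀ {m n} → (m <ᵇ n) ≡ false → ¬ m < n
    ≮ eq m<n = subst T eq (<⇒<ᵇ m<n)
    i≡j : i ≡ j
    i≡j = Fin.toℕ-injective (≤-antisym (≮⇒≥ (≮ j<i)) (≮⇒≥ (≮ i<j)))

colInd-hasColour : ∀ c m → colInd c m ≡ 𝟙 (hasColour c m)
colInd-hasColour true  (just true)  = refl
colInd-hasColour true  (just false) = refl
colInd-hasColour false (just true)  = refl
colInd-hasColour false (just false) = refl
colInd-hasColour true  nothing      = refl
colInd-hasColour false nothing      = refl

edgeInd-hasColour : ∀ m → edgeInd m ≡ 𝟙 (hasColour true m ∨ hasColour false m)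
edgeInd-hasColour (just true)  = refl
edgeInd-hasColour (just false) = refl
edgeInd-hasColour nothing      = refl

-- Having `n` on the left replaces the truncated subtraction in n² - n.
twice-choose-2 : ∀ n → 2 * (n C 2) + n ≡ n * n
twice-choose-2 zero    = refl
twice-choose-2 (suc n) = begin-equality
  2 * (suc n C 2) + suc n          ≡⟨ cong (λ t → 2 * t + suc n) (nCk+nC[k+1]≡[n+1]C[k+1] n 1) ⟨
  2 * (n C 1 + n C 2) + suc n      ≡⟨ cong (λ t → 2 * (t + n C 2) + suc n) (nC1≡n n) ⟩
  2 * (n + n C 2) + suc n          ≡⟨ regroup n (n C 2) ⟩
  2 * (n C 2) + n + (2 * n + 1)    ≡⟨ cong (_+ (2 * n + 1)) (twice-choose-2 n) ⟩
  n * n + (2 * n + 1)              ≡⟨ square n ⟩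
  suc n * suc n                    ∎
  where
  open ≤-Reasoning
  regroup : ∀ n c → 2 * (n + c) + (1 + n) ≡ 2 * c + n + (2 * n + 1)
  regroup = solve-∀
  square : ∀ n → n * n + (2 * n + 1) ≡ (1 + n) * (1 + n)
  square = solve-∀

module _ {n : ℕ} (G : BiGraph n) where

  coloured : Bool → Fin n → Fin n → Bool
  coloured c i j = hasColour c (adj G i j)

  coloured-sym : ∀ c i j → coloured c i j ≡ coloured c j i
  coloured-sym c i j = cong (hasColour c) (BiGraph.sym G i j)

  twice-colEdges : ∀ c → 2 * colEdges c G ≡ between (coloured c) all all
  twice-colEdges c = trans
    (twice-pairSum (λ i j → colInd c (adj G i j)) (λ i j → cong (colInd c) (BiGraph.sym G i j)) (λ i → trans (cong (colInd c) (irrefl G i)) (no-edge c)))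
    (∑∑-cong λ i j → colInd-hasColour c (adj G i j))
    where
    no-edge : ∀ c → colInd c nothing ≡ 0
    no-edge true  = refl
    no-edge false = refl

  twice-edges : 2 * edges G ≡ between (edge G) all all
  twice-edges = trans
    (twice-pairSum (λ i j → edgeInd (adj G i j)) (λ i j → cong edgeInd (BiGraph.sym G i j)) (λ i → cong edgeInd (irrefl G i)))
    (∑∑-cong λ i j → edgeInd-hasColour (adj G i j))

  kites : ℕ
  kites = sum λ c → sum λ d → ∑∑ λ a b → 𝟙 (kite G c d a b)

  popular-kite-base : ∀ L → 0 < n → n * (n * (n * n)) ≤ L * kites →
    ∃[ c ] ∃[ d ] n * n ≤ L * ∑∑ λ a b → 𝟙 (kite G c d a b)
  popular-kite-base L 0<n many =
    let c , many-c = pigeonhole (λ c → L * sum λ d → ∑∑ λ a b → 𝟙 (kite G c d a b)) (n * (n * n)) 0<n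
          (≤-trans many (≤-reflexive (*-distribˡ-sum L (λ c → sum λ d → ∑∑ λ a b → 𝟙 (kite G c d a b)))))
        d , many-d = pigeonhole (λ d → L * ∑∑ λ a b → 𝟙 (kite G c d a b)) (n * n) 0<n
          (≤-trans many-c (≤-reflexive (*-distribˡ-sum L (λ d → ∑∑ λ a b → 𝟙 (kite G c d a b)))))
    in c , d , many-d

  joined⇒cycles : ∀ {c d s} as bs → length as ≡ 2 + s → length bs ≡ 2 + s → Unique as → Unique bs →
    Joined (kite G c d) as bs → ContainsNonMonoCycle (4 + 2 * s) G × ContainsNonMonoCycle (5 + 2 * s) G
  joined⇒cycles (a′ ∷ a₀ ∷ as) (b₀ ∷ b₁ ∷ bs) refl len uniqₐ uniq_b joined =
    cycle-from-kites G (sym (suc-injective (suc-injective len))) uniqₐ uniq_b (All.map (All.map (kite⇒Kite G)) joined)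

  many-kites⇒cycles : ∀ L s t → 0 < n → 0 < L → t ≡ 2 + s →
    4 * L * t ≤ n → 2 * L * ((4 * L) ^ t * t) ≤ n →
    n * (n * (n * n)) ≤ L * kites →
    ContainsNonMonoCycle (4 + 2 * s) G × ContainsNonMonoCycle (5 + 2 * s) G
  many-kites⇒cycles L s t 0<n 0<L t≡ large₁ large₂ many =
    let c , d , dense = popular-kite-base L 0<n many
        as , bs , lenₐ , len_b , uniqₐ , uniq_b , joined =
          complete-bipartite L t (kite G c d) 0<n 0<L (subst (0 <_) (sym t≡) (s≤s z≤n)) large₁ large₂ dense
    in joined⇒cycles as bs (trans lenₐ t≡) (trans len_b t≡) uniqₐ uniq_b joined

  -- Whatever the colour of ab, the vertex `a` has at least n/J edges of the other colour. Excluding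
  -- `c` as an endpoint costs one of them, which `2 * J ≤ n` absorbs, so n/(2J) remain.
  pendant-edges : ∀ J a b c → 2 * J ≤ n → (∀ q → n ≤ J * # (coloured q a)) →
    n * 𝟙 (edge G a b ∧ edge G a c ∧ edge G b c) ≤ 2 * J * # (λ d → kite G c d a b)
  pendant-edges J a b c 2J≤n rich = ≤-trans (≤-reflexive (*-comm n _))
    (𝟙-* triangle λ tri → subst (λ t → n ≤ 2 * J * # (λ d → t ∧ (opposite (adj G a b) (adj G a d) ∧ not ⌊ c Fin.≟ d ⌋)))
      (sym tri) (free-pendants (edge⇒Adj G {a} {b} (∧-trueˡ tri))))
    where
    open ≤-Reasoning
    triangle : Bool
    triangle = edge G a b ∧ edge G a c ∧ edge G b c
    double : ∀ J t → J * t + J * t ≡ 2 * J * t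
    double = solve-∀
    free-pendants : Adj G a b → n ≤ 2 * J * # (λ d → opposite (adj G a b) (adj G a d) ∧ not ⌊ c Fin.≟ d ⌋)
    free-pendants (p , ab) = +-cancelʳ-≤ n _ _ (begin
      n + n                                   ≤⟨ +-mono-≤ (rich (not p)) (rich (not p)) ⟩
      J * deg + J * deg                       ≡⟨ double J deg ⟩
      2 * J * deg                             ≤⟨ *-monoʳ-≤ (2 * J) (#-remove (coloured (not p) a) c) ⟩
      2 * J * (free + 1)                      ≡⟨ *-distribˡ-+ (2 * J) free 1 ⟩
      2 * J * free + 2 * J * 1                ≤⟨ +-monoʳ-≤ (2 * J * free) (≤-trans (≤-reflexive (*-identityʳ (2 * J))) 2J≤n) ⟩
      2 * J * free + n
        ≡⟨ cong (λ m → 2 * J * # (λ d → opposite m (adj G a d) ∧ not ⌊ c Fin.≟ d ⌋) + n) ab ⟨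
      2 * J * # (λ d → opposite (adj G a b) (adj G a d) ∧ not ⌊ c Fin.≟ d ⌋) + n ∎)
      where
      deg free : ℕ
      deg = # (coloured (not p) a)
      free = # (λ d → coloured (not p) a d ∧ not ⌊ c Fin.≟ d ⌋)

  -- These are the vertices whose scarcity `balanced-bound` assumes.
  exceptional : ℕ → Fin n → Bool
  exceptional J v = rich J R B B v ∧ rich J R B R v ∧ triangular J R B v
    where
    R B : Fin n → Fin n → Bool
    R = coloured true
    B = coloured false

  kites-at : Fin n → ℕ
  kites-at a = sum λ c → sum λ d → sum λ b → 𝟙 (kite G c d a b)

  sum-kites-at : sum kites-at ≡ kites
  sum-kites-at = trans (∑-comm (λ a c → sum λ d → sum λ b → 𝟙 (kite G c d a b)))
    (sum-cong-≗ λ c → ∑-comm (λ a d → sum λ b → 𝟙 (kite G c d a b)))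

  -- An ordered adjacent pair (b , c) in N(a) is a triangle at `a`, and `pendant-edges` extends it
  -- to at least n/(2J) kites.
  kites-at-rich : ∀ J a → 2 * J ≤ n → (∀ q → n ≤ J * # (coloured q a)) →
    n * between (edge G) (edge G a) (edge G a) ≤ 2 * J * kites-at a
  kites-at-rich J a 2J≤n rich = begin
    n * ∑∑ (λ b c → tri b c)                ≡⟨ cong (n *_) (∑-comm tri) ⟩
    n * ∑∑ (λ c b → tri b c)                ≡⟨ ∑∑-*ˡ n (λ c b → tri b c) ⟨
    ∑∑ (λ c b → n * tri b c)                ≤⟨ ∑∑-mono (λ c b → pendant-edges J a b c 2J≤n rich) ⟩
    ∑∑ (λ c b → 2 * J * # (λ d → kite G c d a b)) ≡⟨ ∑∑-*ˡ (2 * J) (λ c b → # (λ d → kite G c d a b)) ⟩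
    2 * J * ∑∑ (λ c b → # (λ d → kite G c d a b))
      ≡⟨ cong (2 * J *_) (sum-cong-≗ (λ c → ∑-comm (λ b d → 𝟙 (kite G c d a b)))) ⟩
    2 * J * kites-at a ∎
    where
    open ≤-Reasoning
    tri : Fin n → Fin n → ℕ
    tri b c = 𝟙 (edge G a b ∧ edge G a c ∧ edge G b c)

  -- At least n/J choices of `a`, at least n²/J² triangles at each, and at least n/(2J) pendant
  -- edges for each triangle give n⁴/(2J⁴) kites.
  many-exceptional⇒many-kites : ∀ J → 2 * J ≤ n → n ≤ J * # (exceptional J) →
    n * (n * (n * n)) ≤ 2 * (J * J * J * J) * kites
  many-exceptional⇒many-kites J 2J≤n many = begin
    n * (n * (n * n))                              ≡⟨ *-comm n (n * (n * n)) ⟩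
    n * (n * n) * n                                ≤⟨ *-monoʳ-≤ (n * (n * n)) many ⟩
    n * (n * n) * (J * # (exceptional J))          ≡⟨ swap (n * (n * n)) J (# (exceptional J)) ⟩
    J * (# (exceptional J) * (n * (n * n)))        ≡⟨ cong (J *_) (*-distribʳ-sum (n * (n * n)) (λ a → 𝟙 (exceptional J a))) ⟩
    J * sum (λ a → 𝟙 (exceptional J a) * (n * (n * n))) ≤⟨ *-monoʳ-≤ J (sum-mono pointwise) ⟩
    J * sum (λ a → 2 * (J * J * J) * kites-at a)   ≡⟨ cong (J *_) (*-distribˡ-sum (2 * (J * J * J)) kites-at) ⟨
    J * (2 * (J * J * J) * sum kites-at)           ≡⟨ cong (λ t → J * (2 * (J * J * J) * t)) sum-kites-at ⟩
    J * (2 * (J * J * J) * kites)                  ≡⟨ assoc J kites ⟩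
    2 * (J * J * J * J) * kites                    ∎
    where
    open ≤-Reasoning
    swap : ∀ a b c → a * (b * c) ≡ b * (c * a)
    swap = solve-∀
    assoc : ∀ J k → J * (2 * (J * J * J) * k) ≡ 2 * (J * J * J * J) * k
    assoc = solve-∀
    pointwise : ∀ a → 𝟙 (exceptional J a) * (n * (n * n)) ≤ 2 * (J * J * J) * kites-at a
    pointwise a = 𝟙-* (exceptional J a) λ exc → begin
      n * (n * n)                                              ≤⟨ *-monoʳ-≤ n (<⇒≤ (is-triangular exc)) ⟩
      n * (J * J * T-a)                                        ≡⟨ rotate n (J * J) T-a ⟩
      J * J * (n * T-a)                                        ≤⟨ *-monoʳ-≤ (J * J) (kites-at-rich J a 2J≤n (both exc)) ⟩
      J * J * (2 * J * kites-at a)                             ≡⟨ assoc′ J (kites-at a) ⟩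
      2 * (J * J * J) * kites-at a                             ∎
      where
      R B : Fin n → Fin n → Bool
      R = coloured true
      B = coloured false
      T-a : ℕ
      T-a = between (edge G) (edge G a) (edge G a)
      rotate : ∀ n j t → n * (j * t) ≡ j * (n * t)
      rotate = solve-∀
      assoc′ : ∀ J k → J * J * (2 * J * k) ≡ 2 * (J * J * J) * k
      assoc′ = solve-∀
      is-triangular : exceptional J a ≡ true → n * n < J * J * T-a
      is-triangular exc = ⌊⌋-true (n * n <? J * J * T-a) (∧-trueʳ {rich J R B R a} (∧-trueʳ {rich J R B B a} exc))
      both : exceptional J a ≡ true → ∀ q → n ≤ J * # (coloured q a)
      both exc true  = ⌊⌋-true (n ≤? J * # (R a)) (∧-trueˡ (∧-trueʳ {rich J R B B a} exc))
      both exc false = ⌊⌋-true (n ≤? J * # (B a)) (∧-trueˡ exc)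

-- The two bounds

module _ {n : ℕ} (G : BiGraph n) where

  no-cycle-bound : ∀ J s t → 0 < n → 0 < J → t ≡ 2 + s → 2 * J ≤ n →
    (let L = 2 * (J * J * J * J) in 4 * L * t ≤ n × 2 * L * ((4 * L) ^ t * t) ≤ n) →
    Balanced 1 2 G →
    ¬ (ContainsNonMonoCycle (4 + 2 * s) G × ContainsNonMonoCycle (5 + 2 * s) G) →
    J * (4 * edges G) ≤ (J + 34) * (n * n)
  no-cycle-bound J s t 0<n 0<J t≡ 2J≤n (large₁ , large₂) (red , blue) free = begin
    J * (4 * edges G)                     ≡⟨ cong (J *_) (*-assoc 2 2 (edges G)) ⟩
    J * (2 * (2 * edges G))               ≡⟨ cong (λ S → J * (2 * S)) (twice-edges G) ⟩
    J * (2 * between (edge G) all all)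
      ≤⟨ balanced-bound J (coloured G true) (coloured G false) 0<n 0<J (coloured-sym G true) (coloured-sym G false)
           (half true red) (half false blue) (few (J * # (exceptional G J) ≤? n)) ⟩
    (J + 34) * (n * n)                    ∎
    where
    open ≤-Reasoning
    half : ∀ c → 1 * edges G ≤ 2 * colEdges c G → between (edge G) all all ≤ 2 * between (coloured G c) all all
    half c h = begin
      between (edge G) all all             ≡⟨ twice-edges G ⟨
      2 * edges G                          ≡⟨ cong (2 *_) (*-identityˡ (edges G)) ⟨
      2 * (1 * edges G)                    ≤⟨ *-monoʳ-≤ 2 h ⟩
      2 * (2 * colEdges c G)               ≡⟨ cong (2 *_) (twice-colEdges G c) ⟩
      2 * between (coloured G c) all all   ∎
    0<L : 0 < 2 * (J * J * J * J)
    0<L = *-mono-< {0} {2} {0} (s≤s z≤n) (*-mono-< {0} {J * J * J} {0} (*-mono-< {0} {J * J} {0} (*-mono-< {0} {J} {0} 0<J 0<J) 0<J) 0<J)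
    -- More than n/J exceptional vertices would give kites of density 1/L with L = 2J⁴, and hence
    -- cycles of both lengths.
    few : Dec (J * # (exceptional G J) ≤ n) → J * # (exceptional G J) ≤ n
    few (yes h) = h
    few (no ¬h) = contradiction
      (many-kites⇒cycles G (2 * (J * J * J * J)) s t 0<n 0<L t≡ large₁ large₂
        (many-exceptional⇒many-kites G J 2J≤n (<⇒≤ (≰⇒> ¬h))))
      free

-- After division by 34 the hypothesis reads 4Me ≤ (M + 1)n². One further n² pays for passing to (M
-- + 2)(n² - n), because (M + 2)n ≤ n².
upper-arithmetic : ∀ M n e → 0 < n → 0 < M → M + 2 ≤ n →
  34 * M * (4 * e) ≤ (34 * M + 34) * (n * n) → 2 * M * e ≤ (M + 2) * (n C 2)
upper-arithmetic M n e 0<n 0<M M+2≤n h = *-cancelˡ-≤ 68 (+-cancelʳ-≤ (34 * ((M + 2) * n)) _ _ (begin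
  68 * (2 * M * e) + 34 * ((M + 2) * n)          ≡⟨ cong (_+ 34 * ((M + 2) * n)) (regroup M e) ⟩
  34 * M * (4 * e) + 34 * ((M + 2) * n)          ≤⟨ +-mono-≤ h (*-monoʳ-≤ 34 (*-monoˡ-≤ n M+2≤n)) ⟩
  (34 * M + 34) * (n * n) + 34 * (n * n)         ≡⟨ collect M (n * n) ⟩
  34 * ((M + 2) * (n * n))                       ≡⟨ cong (λ t → 34 * ((M + 2) * t)) (twice-choose-2 n) ⟨
  34 * ((M + 2) * (2 * (n C 2) + n))             ≡⟨ expand M (n C 2) n ⟩
  68 * ((M + 2) * (n C 2)) + 34 * ((M + 2) * n)  ∎))
  where
  open ≤-Reasoning
  regroup : ∀ M e → 68 * (2 * M * e) ≡ 34 * M * (4 * e)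
  regroup = solve-∀
  collect : ∀ M t → (34 * M + 34) * t + 34 * t ≡ 34 * ((M + 2) * t)
  collect = solve-∀
  expand : ∀ M c n → 34 * ((M + 2) * (2 * c + n)) ≡ 68 * ((M + 2) * c) + 34 * ((M + 2) * n)
  expand = solve-∀

-- The extremal example: a red and a blue clique

#-below : ∀ {n} h → h ≤ n → # {n} (λ i → toℕ i <ᵇ h) ≡ h
#-below {n}     zero    _         = trans (sum-const n 0) (*-zeroʳ n)
#-below {suc n} (suc h) (s≤s h≤n) = cong suc (#-below h h≤n)

common : Maybe Bool → Maybe Bool → Maybe Bool
common (just true)  (just true)  = just true
common (just false) (just false) = just false
common _            _            = nothing

common-comm : ∀ a b → common a b ≡ common b a
common-comm (just true)  (just true)  = refl
common-comm (just true)  (just false) = refl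
common-comm (just false) (just true)  = refl
common-comm (just false) (just false) = refl
common-comm (just true)  nothing      = refl
common-comm (just false) nothing      = refl
common-comm nothing      (just true)  = refl
common-comm nothing      (just false) = refl
common-comm nothing      nothing      = refl

common-just : ∀ a b {c} → common a b ≡ just c → a ≡ just c × b ≡ just c
common-just (just true)  (just true)  refl = refl , refl
common-just (just false) (just false) refl = refl , refl

module TwoCliques (n h : ℕ) (2h≤n : h + h ≤ n) where

  -- The first `h` vertices form the red clique and the next `h` the blue one. Any further vertex is
  -- isolated; for h = ⌊n/2⌋ there is at most one, and the two colours stay exactly balanced.
  side : Fin n → Maybe Bool
  side i = if toℕ i <ᵇ h then just true else if toℕ i <ᵇ h + h then just false else nothing

  cliques : BiGraph n
  cliques .adj i j = if ⌊ i Fin.≟ j ⌋ then nothing else common (side i) (side j)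
  cliques .BiGraph.sym i j with i Fin.≟ j | j Fin.≟ i
  ... | yes _   | yes _   = refl
  ... | no _    | no _    = common-comm (side i) (side j)
  ... | yes i≡j | no j≢i  = contradiction (sym i≡j) j≢i
  ... | no i≢j  | yes j≡i = contradiction (sym j≡i) i≢j
  cliques .irrefl i with i Fin.≟ i
  ... | yes _  = refl
  ... | no i≢i = contradiction refl i≢i

  adj⇒side : ∀ {i j c} → adj cliques i j ≡ just c → side i ≡ just c × side j ≡ just c
  adj⇒side {i} {j} e with i Fin.≟ j
  ... | no _ = common-just (side i) (side j) e

  -- Each edge has the colour of the side of either end, so the two cycle edges meeting at a vertex
  -- agree in colour, and the colour is constant around the cycle.
  no-cycle : ∀ {k} → ¬ ContainsNonMonoCycle k cliques
  no-cycle {suc k} (col , (i , j , i≢j) , f , _ , f-adj) =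
    i≢j (trans (constant (toℕ i) i refl) (sym (constant (toℕ j) j refl)))
    where
    step : ∀ i → col (next i) ≡ col i
    step i = just-injective (trans (sym (proj₁ (adj⇒side (f-adj (next i))))) (proj₂ (adj⇒side (f-adj i))))
    constant : ∀ m i → toℕ i ≡ m → col i ≡ col zero
    constant zero    zero    eq = refl
    constant (suc m) (suc i) eq = trans (cong col (sym next-i′)) (trans (step i′) (constant m i′ (trans toℕ-i′ (suc-injective eq))))
      where
      i′ : Fin (suc k)
      i′ = inject₁ i
      toℕ-i′ : toℕ i′ ≡ toℕ i
      toℕ-i′ = Fin.toℕ-inject₁ i
      next-i′ : next i′ ≡ suc i
      next-i′ = Fin.toℕ-injective (trans (toℕ-mod (suc (toℕ i′)))
        (trans (cong (λ t → suc t % suc k) toℕ-i′) (m<n⇒m%n≡m (s≤s (Fin.toℕ<n i)))))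

  #-side : ∀ c → # (λ i → hasColour c (side i)) ≡ h
  #-side true  = trans (sum-cong-≗ pointwise) (#-below h (≤-trans (m≤m+n h h) 2h≤n))
    where
    pointwise : ∀ i → 𝟙 (hasColour true (side i)) ≡ 𝟙 (toℕ i <ᵇ h)
    pointwise i with toℕ i <ᵇ h | toℕ i <ᵇ h + h
    ... | true  | _     = refl
    ... | false | true  = refl
    ... | false | false = refl
  #-side false = +-cancelˡ-≡ h _ _ (begin-equality
    h + # (λ i → hasColour false (side i))
      ≡⟨ cong (_+ # (λ i → hasColour false (side i))) (#-below h (≤-trans (m≤m+n h h) 2h≤n)) ⟨
    # {n} (λ i → toℕ i <ᵇ h) + # (λ i → hasColour false (side i))
      ≡⟨ ∑-distrib-+ (λ i → 𝟙 (toℕ i <ᵇ h)) (λ i → 𝟙 (hasColour false (side i))) ⟨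
    sum (λ i → 𝟙 (toℕ i <ᵇ h) + 𝟙 (hasColour false (side i)))
      ≡⟨ sum-cong-≗ pointwise ⟩
    # {n} (λ i → toℕ i <ᵇ h + h)
      ≡⟨ #-below (h + h) 2h≤n ⟩
    h + h ∎)
    where
    open ≤-Reasoning
    pointwise : ∀ i → 𝟙 (toℕ i <ᵇ h) + 𝟙 (hasColour false (side i)) ≡ 𝟙 (toℕ i <ᵇ h + h)
    pointwise i with toℕ i <ᵇ h in i<h | toℕ i <ᵇ h + h in i<2h
    ... | true  | true  = refl
    ... | false | true  = refl
    ... | false | false = refl
    ... | true  | false = contradiction (subst T i<2h (<⇒<ᵇ (<-≤-trans (<ᵇ⇒< (toℕ i) h (subst T (sym i<h) tt)) (m≤m+n h h)))) λ ()

  -- The ordered edges of one clique together with its `h` diagonal pairs fill the whole h × h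
  -- square.
  colour-count : ∀ c → 2 * colEdges c cliques + h ≡ h * h
  colour-count c = begin-equality
    2 * colEdges c cliques + h
      ≡⟨ cong₂ _+_ (twice-colEdges cliques c) (sym (trans diagonal (#-side c))) ⟩
    ∑∑ (λ i j → 𝟙 (coloured cliques c i j)) + ∑∑ (λ i j → 𝟙 (p i) * 𝟙 ⌊ i Fin.≟ j ⌋)
      ≡⟨ ∑∑-+ (λ i j → 𝟙 (coloured cliques c i j)) (λ i j → 𝟙 (p i) * 𝟙 ⌊ i Fin.≟ j ⌋) ⟨
    ∑∑ (λ i j → 𝟙 (coloured cliques c i j) + 𝟙 (p i) * 𝟙 ⌊ i Fin.≟ j ⌋)
      ≡⟨ ∑∑-cong pointwise ⟩
    ∑∑ (λ i j → 𝟙 (p i) * 𝟙 (p j))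
      ≡⟨ ∑∑-* (λ i → 𝟙 (p i)) (λ j → 𝟙 (p j)) ⟩
    # p * # p
      ≡⟨ cong (λ t → t * t) (#-side c) ⟩
    h * h ∎
    where
    open ≤-Reasoning
    p : Fin n → Bool
    p i = hasColour c (side i)
    diagonal : ∑∑ (λ i j → 𝟙 (p i) * 𝟙 ⌊ i Fin.≟ j ⌋) ≡ # p
    diagonal = trans (sum-factor {f = λ i → 𝟙 (p i)} {g = λ i j → 𝟙 ⌊ i Fin.≟ j ⌋})
      (sum-cong-≗ λ i → trans (cong (𝟙 (p i) *_) (#-singleton i)) (*-identityʳ (𝟙 (p i))))
    square : ∀ b → 0 + 𝟙 b * 1 ≡ 𝟙 b * 𝟙 b
    square true  = refl
    square false = refl
    product : ∀ c a b → 𝟙 (hasColour c (common a b)) + 𝟙 (hasColour c a) * 0 ≡ 𝟙 (hasColour c a) * 𝟙 (hasColour c b)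
    product true  (just true)  (just true)  = refl
    product true  (just true)  (just false) = refl
    product true  (just true)  nothing      = refl
    product true  (just false) (just true)  = refl
    product true  (just false) (just false) = refl
    product true  (just false) nothing      = refl
    product true  nothing      _            = refl
    product false (just true)  (just true)  = refl
    product false (just true)  (just false) = refl
    product false (just true)  nothing      = refl
    product false (just false) (just true)  = refl
    product false (just false) (just false) = refl
    product false (just false) nothing      = refl
    product false nothing      _            = refl
    pointwise : ∀ i j → 𝟙 (coloured cliques c i j) + 𝟙 (p i) * 𝟙 ⌊ i Fin.≟ j ⌋ ≡ 𝟙 (p i) * 𝟙 (p j)
    pointwise i j with i Fin.≟ j
    ... | yes refl = trans (cong (λ b → 𝟙 b + 𝟙 (p i) * 1) (none-coloured c)) (square (p i))
      where
      none-coloured : ∀ c → hasColour c nothing ≡ false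
      none-coloured true  = refl
      none-coloured false = refl
    ... | no  _    = product c (side i) (side j)

  edge-split : edges cliques ≡ colEdges true cliques + colEdges false cliques
  edge-split = *-cancelˡ-≡ _ _ 2 (begin-equality
    2 * edges cliques
      ≡⟨ twice-edges cliques ⟩
    between (edge cliques) all all
      ≡⟨ ∑∑-cong (λ i j → pointwise (adj cliques i j)) ⟩
    ∑∑ (λ i j → 𝟙 (coloured cliques true i j) + 𝟙 (coloured cliques false i j))
      ≡⟨ ∑∑-+ (λ i j → 𝟙 (coloured cliques true i j)) (λ i j → 𝟙 (coloured cliques false i j)) ⟩
    between (coloured cliques true) all all + between (coloured cliques false) all all
      ≡⟨ cong₂ _+_ (twice-colEdges cliques true) (twice-colEdges cliques false) ⟨
    2 * colEdges true cliques + 2 * colEdges false cliques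
      ≡⟨ *-distribˡ-+ 2 (colEdges true cliques) (colEdges false cliques) ⟨
    2 * (colEdges true cliques + colEdges false cliques) ∎)
    where
    open ≤-Reasoning
    pointwise : ∀ m → 𝟙 (hasColour true m ∨ hasColour false m) ≡ 𝟙 (hasColour true m) + 𝟙 (hasColour false m)
    pointwise (just true)  = refl
    pointwise (just false) = refl
    pointwise nothing      = refl

  same-count : colEdges true cliques ≡ colEdges false cliques
  same-count = *-cancelˡ-≡ _ _ 2 (+-cancelʳ-≡ h _ _ (trans (colour-count true) (sym (colour-count false))))

  edges≡2*colEdges : ∀ c → edges cliques ≡ 2 * colEdges c cliques
  edges≡2*colEdges c = trans edge-split (trans (both c) (cong (colEdges c cliques +_) (sym (+-identityʳ _))))
    where
    both : ∀ c → colEdges true cliques + colEdges false cliques ≡ colEdges c cliques + colEdges c cliques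
    both true  = cong (colEdges true cliques +_) (sym same-count)
    both false = cong (_+ colEdges false cliques) same-count

  edge-count : edges cliques + h ≡ h * h
  edge-count = trans (cong (_+ h) (edges≡2*colEdges true)) (colour-count true)

  balanced : Balanced 1 2 cliques
  balanced = half true , half false
    where
    half : ∀ c → 1 * edges cliques ≤ 2 * colEdges c cliques
    half c = ≤-reflexive (trans (*-identityˡ _) (edges≡2*colEdges c))

-- From e = h² - h with h = ⌊n/2⌋ one gets n² ≤ 4e + 4n, where `r` accounts for odd n. Substituting
-- n² - n for twice the binomial coefficient leaves an error 3Mn, and this is at most 2(n² - n) once
-- 3M + 2 ≤ 2n.
lower-arithmetic : ∀ M n h r e → n ≡ r + h * 2 → r ≤ 1 → e + h ≡ h * h → 3 * M + 2 ≤ 2 * n →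
  M * (n C 2) ≤ 2 * M * e + 2 * (n C 2)
lower-arithmetic M n h r e n≡ r≤1 e+h≡ large =
  *-cancelˡ-≤ 2 (+-cancelʳ-≤ ((3 * M + 2) * n) _ _ (begin
    2 * (M * (n C 2)) + (3 * M + 2) * n               ≡⟨ regroup M (n C 2) n ⟩
    M * (2 * (n C 2) + n) + (2 * M + 2) * n           ≡⟨ cong (λ t → M * t + (2 * M + 2) * n) (twice-choose-2 n) ⟩
    M * (n * n) + (2 * M + 2) * n                     ≤⟨ +-monoˡ-≤ ((2 * M + 2) * n) (*-monoʳ-≤ M n²≤) ⟩
    M * (4 * e + 4 * n) + (2 * M + 2) * n             ≡⟨ collect M e n ⟩
    2 * (2 * M * e) + ((3 * M + 2) * n + 3 * M * n)   ≤⟨ +-monoʳ-≤ (2 * (2 * M * e)) (+-monoʳ-≤ ((3 * M + 2) * n) 3Mn≤) ⟩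
    2 * (2 * M * e) + ((3 * M + 2) * n + 4 * (n C 2)) ≡⟨ final (2 * M * e) ((3 * M + 2) * n) (n C 2) ⟩
    2 * (2 * M * e + 2 * (n C 2)) + (3 * M + 2) * n   ∎))
  where
  open ≤-Reasoning
  regroup : ∀ M c n → 2 * (M * c) + (3 * M + 2) * n ≡ M * (2 * c + n) + (2 * M + 2) * n
  regroup = solve-∀
  collect : ∀ M e n → M * (4 * e + 4 * n) + (2 * M + 2) * n ≡ 2 * (2 * M * e) + ((3 * M + 2) * n + 3 * M * n)
  collect = solve-∀
  final : ∀ a b c → 2 * a + (b + 4 * c) ≡ 2 * (a + 2 * c) + b
  final = solve-∀
  r²≤r : r * r ≤ r
  r²≤r = ≤-trans (*-monoˡ-≤ r r≤1) (≤-reflexive (*-identityˡ r))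
  n²≤ : n * n ≤ 4 * e + 4 * n
  n²≤ = begin
    n * n                                    ≡⟨ cong (λ t → t * t) n≡ ⟩
    (r + h * 2) * (r + h * 2)                ≡⟨ square r h ⟩
    4 * (h * h) + 4 * h * r + r * r          ≤⟨ +-mono-≤ (+-monoʳ-≤ (4 * (h * h)) (*-monoʳ-≤ (4 * h) r≤1)) r²≤r ⟩
    4 * (h * h) + 4 * h * 1 + r              ≡⟨ cong (λ t → 4 * t + 4 * h * 1 + r) e+h≡ ⟨
    4 * (e + h) + 4 * h * 1 + r              ≤⟨ m≤m+n _ (3 * r) ⟩
    4 * (e + h) + 4 * h * 1 + r + 3 * r      ≡⟨ sum-up e h r ⟩
    4 * e + 4 * (r + h * 2)                  ≡⟨ cong (λ t → 4 * e + 4 * t) n≡ ⟨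
    4 * e + 4 * n                            ∎
    where
    square : ∀ r h → (r + h * 2) * (r + h * 2) ≡ 4 * (h * h) + 4 * h * r + r * r
    square = solve-∀
    sum-up : ∀ e h r → 4 * (e + h) + 4 * h * 1 + r + 3 * r ≡ 4 * e + 4 * (r + h * 2)
    sum-up = solve-∀
  3Mn≤ : 3 * M * n ≤ 4 * (n C 2)
  3Mn≤ = +-cancelʳ-≤ (2 * n) _ _ (begin
    3 * M * n + 2 * n          ≡⟨ *-distribʳ-+ n (3 * M) 2 ⟨
    (3 * M + 2) * n            ≤⟨ *-monoˡ-≤ n large ⟩
    2 * n * n                  ≡⟨ *-assoc 2 n n ⟩
    2 * (n * n)                ≡⟨ cong (2 *_) (twice-choose-2 n) ⟨
    2 * (2 * (n C 2) + n)      ≡⟨ *-distribˡ-+ 2 (2 * (n C 2)) n ⟩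
    2 * (2 * (n C 2)) + 2 * n  ≡⟨ cong (_+ 2 * n) (*-assoc 2 2 (n C 2)) ⟨
    4 * (n C 2) + 2 * n        ∎)

lower-bound : ∀ k M n → 3 * M + 2 ≤ 2 * n →
  Σ[ G ∈ BiGraph n ] (Balanced 1 2 G × ¬ ContainsNonMonoCycle k G × M * (n C 2) ≤ 2 * M * edges G + 2 * (n C 2))
lower-bound k M n large = cliques , balanced , no-cycle ,
  lower-arithmetic M n (n / 2) (n % 2) (edges cliques) (m≡m%n+[m/n]*n n 2) (≤-pred (m%n<n n 2)) edge-count large
  where
  double : ∀ h → h + h ≡ h * 2
  double = solve-∀
  open TwoCliques n (n / 2) (≤-trans (≤-trans (≤-reflexive (double (n / 2))) (m≤n+m (n / 2 * 2) (n % 2)))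
                                     (≤-reflexive (sym (m≡m%n+[m/n]*n n 2))))

-- The counting leaves an error of 34 n²/J, so J = 34 M makes it n²/M.
threshold : ℕ → ℕ → ℕ
threshold M t = 2 * J + (4 * L * t + (2 * L * ((4 * L) ^ t * t) + (3 * M + 2)))
  where
  J = 34 * M
  L = 2 * (J * J * J * J)

-- Many kites yield cycles of lengths 4 + 2s and 5 + 2s together; `contains` selects the one whose
-- length is `k`.
asymptotic : ∀ k s M → 0 < M →
  (∀ {n} {G : BiGraph n} → ContainsNonMonoCycle (4 + 2 * s) G × ContainsNonMonoCycle (5 + 2 * s) G → ContainsNonMonoCycle k G) →
  ∀ n → threshold M (2 + s) ≤ n →
    ((G : BiGraph n) → Balanced 1 2 G → ¬ ContainsNonMonoCycle k G → 2 * M * edges G ≤ (M + 2) * (n C 2)) ×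
    (Σ[ G ∈ BiGraph n ] (Balanced 1 2 G × ¬ ContainsNonMonoCycle k G × M * (n C 2) ≤ 2 * M * edges G + 2 * (n C 2)))
asymptotic k s M 0<M contains n large = go (2 + s) refl large
  where
  go : ∀ t → t ≡ 2 + s → threshold M t ≤ n →
    ((G : BiGraph n) → Balanced 1 2 G → ¬ ContainsNonMonoCycle k G → 2 * M * edges G ≤ (M + 2) * (n C 2)) ×
    (Σ[ G ∈ BiGraph n ] (Balanced 1 2 G × ¬ ContainsNonMonoCycle k G × M * (n C 2) ≤ 2 * M * edges G + 2 * (n C 2)))
  go t t≡ large =
    (λ G bal free → upper-arithmetic M n (edges G) 0<n 0<M (≤-trans (+-monoˡ-≤ 2 (m≤n*m M 3)) ≤₄)
      (no-cycle-bound G (34 * M) s t 0<n (*-mono-< {0} {34} {0} (s≤s z≤n) 0<M) t≡ ≤₁ (≤₂ , ≤₃) bal (free ∘ contains {n} {G})))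
    , lower-bound k M n (≤-trans ≤₄ (m≤n*m n 2))
    where
    J L : ℕ
    J = 34 * M
    L = 2 * (J * J * J * J)
    rest₁ : 4 * L * t + (2 * L * ((4 * L) ^ t * t) + (3 * M + 2)) ≤ n
    rest₁ = m+n≤o⇒n≤o (2 * J) large
    rest₂ : 2 * L * ((4 * L) ^ t * t) + (3 * M + 2) ≤ n
    rest₂ = m+n≤o⇒n≤o (4 * L * t) rest₁
    ≤₁ : 2 * J ≤ n
    ≤₁ = m+n≤o⇒m≤o (2 * J) large
    ≤₂ : 4 * L * t ≤ n
    ≤₂ = m+n≤o⇒m≤o (4 * L * t) rest₁
    ≤₃ : 2 * L * ((4 * L) ^ t * t) ≤ n
    ≤₃ = m+n≤o⇒m≤o (2 * L * ((4 * L) ^ t * t)) rest₂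
    ≤₄ : 3 * M + 2 ≤ n
    ≤₄ = m+n≤o⇒n≤o (2 * L * ((4 * L) ^ t * t)) rest₂
    0<n : 0 < n
    0<n = ≤-trans (≤-trans (s≤s z≤n) (m≤n+m 2 (3 * M))) ≤₄

-- The limit is spelled out with error 1/M for M = `suc m`: for all large n, every admissible graph
-- has at most (1/2 + 1/M) times `n C 2` edges, and some admissible graph has at least (1/2 - 1/M)
-- times as many.
theorem1p5 : (k : ℕ) → 4 ≤ k → (m : ℕ) → ∃[ N ] ((n : ℕ) → N ≤ n →
    (((G : BiGraph n) → Balanced 1 2 G → ¬ ContainsNonMonoCycle k G →
    2 * suc m * edges G ≤ (suc m + 2) * (n C 2))
    × (Σ[ G ∈ BiGraph n ] (Balanced 1 2 G × ¬ ContainsNonMonoCycle k G ×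
    suc m * (n C 2) ≤ 2 * suc m * edges G + 2 * (n C 2)))))
theorem1p5 k 4≤k m with evenOrOdd k 4≤k
... | even s = threshold (suc m) (2 + s) , asymptotic _ s (suc m) (s≤s z≤n) (λ {n} {G} → proj₁)
... | odd s  = threshold (suc m) (2 + s) , asymptotic _ s (suc m) (s≤s z≤n) (λ {n} {G} → proj₂)
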